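{- Let $k,n$ be non-negative integers and let $p_1,\dots,p_{k+1}$ be primes with $p_i\equiv 3\pmod 4$ for each $1\le i\le k+1$. Then for every integer $j$ not divisible by $p_{k+1}$, \[ \mathcal{J}_{10}\Big(p_1^2p_2^2\cdots p_k^2\,p_{k+1}\big(4p_{k+1}n+4j+p_{k+1}\big)\Big)\equiv 0\pmod 2. \]
   Context: Let $q=e^{2\pi i\tau}$ with $\tau$ in the upper half-plane, and let $\eta(\tau)=q^{1/24}\prod_{n\ge1}(1-q^n)$ be the Dedekind eta function. The Hauptmodul of $\Gamma_0(10)$ is \[ j_{10}(\tau)=\frac{\eta(2\tau)\eta(5\tau)^5}{\eta(\tau)\eta(10\tau)^5}-1=\frac1q+\sum_{n\ge1}\mathcal{J}_{10}(n)q^n, \] and $\mathcal{J}_{10}(n)$ denotes its $n$-th Fourier coefficient (an integer). -}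

module Defs where

open import Data.Nat as ℕ using (ℕ; zero; suc; _≤?_; _∸_)
open import Data.Integer as ℤ using (ℤ; +_; -[1+_]; +[1+_])
open import Relation.Nullary using (yes; no)

Series : Set
Series = ℕ → ℤ

one : Series
one zero    = + 1
one (suc _) = + 0

mulFactor : ℕ → Series → Series
mulFactor a f n with a ≤? n
... | yes _ = f n ℤ.- f (n ∸ a)
... | no  _ = f n

-- multiply by 1/(1 - q^a) = Σ_{k≥0} q^{a k}  (a ≥ 1), with fuel bounding the
-- number of terms: divFuel fuel a f n = Σ_{k < fuel, a k ≤ n} f (n - a k)
divFuel : ℕ → ℕ → Series → Series
divFuel zero       a f n = + 0
divFuel (suc fuel) a f n with a ≤? n
... | yes _ = f n ℤ.+ divFuel fuel a f (n ∸ a)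
... | no  _ = f n

-- multiply by 1/(1 - q^(suc b))  (fuel n+1 suffices since suc b ≥ 1)
divFactor : ℕ → Series → Series
divFactor b f n = divFuel (suc n) (suc b) f n

iter : ℕ → (Series → Series) → Series → Series
iter zero    g f = f
iter (suc k) g f = g (iter k g f)

-- one factor of the eta quotient, for m = suc b ≥ 1:
--   (1 - q^{2m}) (1 - q^{5m})^5 / ((1 - q^m) (1 - q^{10m})^5)
etaFactor : ℕ → Series → Series
etaFactor b f =
  let m = suc b in
  mulFactor (2 ℕ.* m) (iter 5 (mulFactor (5 ℕ.* m))
    (divFactor b (iter 5 (divFactor (10 ℕ.* m ℕ.∸ 1)) f)))

partialProd : ℕ → Series
partialProd zero    = one
partialProd (suc M) = etaFactor M (partialProd M)

-- coefficient of q^N in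
--   F(q) = ∏_{m≥1} (1-q^{2m})(1-q^{5m})^5 / ((1-q^m)(1-q^{10m})^5)
-- (factors with m > N do not affect the coefficient of q^N)
Fcoef : ℕ → ℤ
Fcoef N = partialProd N N

-- j10(τ) = η(2τ)η(5τ)^5/(η(τ)η(10τ)^5) - 1 = q^{-1} F(q) - 1.
-- J10 m = coefficient of q^m in the Laurent expansion of j10, for every m ∈ ℤ
-- (so J10 (-1) = 1, J10 m = 0 for m < -1, J10 n = 𝒥₁₀(n) for n ≥ 1).
J10 : ℤ → ℤ
J10 (+ zero)      = Fcoef 1 ℤ.- + 1
J10 +[1+ n ]      = Fcoef (suc (suc n))
J10 -[1+ zero ]   = Fcoef 0
J10 -[1+ suc _ ]  = + 0

{-# OPTIONS --safe #-}

-- Write E_t = ∏ (1 - q^(t m)). Modulo 2 one has E_t² = E_{2t}, so q (j₁₀ + 1) becomes G = E₁ / E₅⁵.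
-- The heart of the proof is the congruence
--     E₁ E₅ ≡ E₂³ + q E₁₀³   (mod 2).
-- By the Jacobi triple product E₁ E₅ is a product of two theta series, and its coefficient at n
-- counts the s + t √-1 of norm 4 n + 1 with s + 2 t ≡ -1 (mod 5). Rotating by units, this is the
-- number of those with s ≡ 1 (mod 4), minus the number of those divisible by 1 + 2 √-1; the
-- involution t ↦ - t makes the two counts odd exactly when 4 n + 1 is a square, respectively five
-- times a square. On the other side E_t³ modulo 2 is the series of q^(t k (k + 1) / 2).
-- Dissecting G twice with the congruence shows that its coefficient at 4 m + 2, which is 𝒥₁₀(4 m + 1),
-- has the parity of the coefficient of E₁ E₅ at m. So 𝒥₁₀(4 m + 1) is odd only if 4 m + 1 is a
-- square or five times a square, and the number in the theorem is neither, because p_{k+1} divides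
-- it to an odd power.

module Submission where

open import Defs
open import Data.Nat as ℕ using (ℕ; zero; suc; _%_; _<_; _≤_; z≤n; s≤s; _≡ᵇ_; _<?_; _≤?_; _∸_)
open import Data.Nat.Primality using (Prime; euclidsLemma; prime⇒nonZero)
open import Data.Fin using (Fin; fromℕ; inject₁)
open import Data.Fin.Properties using ()
open import Data.Integer as ℤ using (ℤ; +_; +[1+_]; -[1+_]; _⊖_; ∣_∣; _+_; _*_; _-_; -_; _≟_)
open import Data.Integer.Divisibility using (_∣_)
open import Data.Vec.Functional using ()
open import Data.List using (List; []; _∷_; _++_; map; length; filter; applyUpTo; cartesianProduct; allFin)
open import Data.Nat.ListAction using (product)
open import Relation.Nullary using (Dec; does; yes; no; ¬_; contradiction; _×-dec_; ¬?)
open import Relation.Binary.PropositionalEquality using (_≡_; _≢_; _≗_; refl; sym; trans; cong; cong₂; subst; module ≡-Reasoning)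
open import Algebra using (CommutativeRing)
open import Algebra.Solver.Ring.AlmostCommutativeRing using (AlmostCommutativeRing; fromCommutativeRing; _-Raw-AlmostCommutative⟶_)
import Algebra.Solver.Ring
open import Data.Bool using (Bool; true; false; not; _∧_; _xor_)
open import Data.Bool.Properties using (∧-comm; ∧-assoc; ∧-distribʳ-xor; xor-assoc; xor-comm; xor-identityʳ; xor-same; xor-∧-commutativeRing; not-involutive; ¬-not)
open import Data.Bool.Solver using (module xor-∧-Solver)
open import Data.Integer.DivMod using (_%ℕ_; _/ℕ_; n%ℕd<d; a≡a%ℕn+[a/ℕn]*n)
open import Data.Integer.Divisibility.Signed as ℤ∣ using (divides; _∣?_)
import Data.Integer.Properties as ℤₚ
import Data.Integer.Tactic.RingSolver as ℤ-Ring
open import Data.List.Membership.Propositional using (_∈_)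
open import Data.List.Membership.Propositional.Properties using (∈-applyUpTo⁺; ∈-cartesianProduct⁺; ∈-filter⁺; ∈-filter⁻; ∈-map⁺; ∈-map⁻)
open import Data.List.Membership.Propositional.Properties.WithK using (unique∧set⇒bag)
open import Data.List.Properties using (length-map)
open import Data.List.Relation.Binary.BagAndSetEquality using (∼bag⇒↭)
open import Data.List.Relation.Binary.Permutation.Propositional.Properties using (↭-length)
open import Data.List.Relation.Unary.Unique.Propositional using (Unique)
import Data.List.Relation.Unary.Unique.Propositional.Properties as Unique
open import Data.Maybe using (Maybe; just; nothing)
open import Data.Nat.DivMod using (m≡m%n+[m/n]*n)
import Data.Nat.Divisibility as ℕ∣
import Data.Nat.Properties as ℕₚ
import Data.Nat.Tactic.RingSolver as ℕ-Ring
open import Data.Product using (_,_; _×_; ∃; proj₁; proj₂)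
open import Data.Sum using (_⊎_; inj₁; inj₂; [_,_]′)
open import Function using (id; _∘_; mk⇔)
open import Level using (0ℓ)
open import Relation.Nullary.Decidable using (does-⇔; dec-true; from-no)
open import Relation.Unary using (Pred; Decidable)
import Relation.Binary.Reasoning.Setoid

-- Power series over 𝔽₂

-- Products stop after M factors and are compared modulo q^N. Quotient identities are proved after
-- clearing denominators, and division becomes cancellation of a series with constant term 1. A
-- power of E₅ in a denominator is always raised to an even one before a dissection: it is then a
-- series in q² and passes through the extraction of even or odd coefficients.
--
-- The two normalisations of Gaussian integers have different merits. The condition modulo 5 is the
-- one that the theta series produce, but t ↦ - t does not preserve it. The condition s ≡ 1 (mod 4)
-- is preserved, and it too selects one associate from each orbit. The points divisible by 1 + 2 √-1
-- are the price of the exchange: they have an associate of the second kind but none of the first.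

𝔽₂⟦q⟧ : Set
𝔽₂⟦q⟧ = ℕ → Bool

infixl 6 _⊕_
infixl 7 _·_

opaque

  _⊕_ : 𝔽₂⟦q⟧ → 𝔽₂⟦q⟧ → 𝔽₂⟦q⟧
  (f ⊕ g) n = f n xor g n

  -- Writes f as f 0 + q (f ∘ suc), so that the Cauchy product needs no finite sums.
  _·_ : 𝔽₂⟦q⟧ → 𝔽₂⟦q⟧ → 𝔽₂⟦q⟧
  (f · g) zero    = f 0 ∧ g 0
  (f · g) (suc n) = (f 0 ∧ g (suc n)) xor (f ∘ suc · g) n

  𝟘 : 𝔽₂⟦q⟧
  𝟘 _ = false

  q^_ : ℕ → 𝔽₂⟦q⟧
  (q^ a) n = a ≡ᵇ n

𝟙 : 𝔽₂⟦q⟧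
𝟙 = q^ 0

opaque
  unfolding _⊕_

  coeff-⊕ : ∀ f g n → (f ⊕ g) n ≡ f n xor g n
  coeff-⊕ f g n = refl

  coeff-𝟘 : ∀ n → 𝟘 n ≡ false
  coeff-𝟘 n = refl

  coeff-q^ : ∀ a n → (q^ a) n ≡ (a ≡ᵇ n)
  coeff-q^ a n = refl

  ·-coeff-zero : ∀ f g → (f · g) 0 ≡ f 0 ∧ g 0
  ·-coeff-zero f g = refl

  ·-coeff-suc : ∀ f g n → (f · g) (suc n) ≡ (f 0 ∧ g (suc n)) xor (f ∘ suc · g) n
  ·-coeff-suc f g n = refl

  ·-zeroˡ : ∀ g → 𝟘 · g ≗ 𝟘
  ·-zeroˡ g zero    = refl
  ·-zeroˡ g (suc n) = ·-zeroˡ g n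

  ·-identityˡ : ∀ g → 𝟙 · g ≗ g
  ·-identityˡ g zero    = refl
  ·-identityˡ g (suc n) = trans (cong (g (suc n) xor_) (·-zeroˡ g n)) (xor-identityʳ _)

  ·-distribʳ-⊕ : ∀ h f g → (f ⊕ g) · h ≗ f · h ⊕ g · h
  ·-distribʳ-⊕ h f g zero    = ∧-distribʳ-xor (h 0) (f 0) (g 0)
  ·-distribʳ-⊕ h f g (suc n)
    rewrite ·-distribʳ-⊕ h (f ∘ suc) (g ∘ suc) n =
    solve 5 (λ a b c x y → (a :+ b) :* c :+ (x :+ y) := (a :* c :+ x) :+ (b :* c :+ y)) refl
      (f 0) (g 0) (h (suc n)) ((f ∘ suc · h) n) ((g ∘ suc · h) n)
    where open xor-∧-Solver

  ·-scaleˡ : ∀ c f g n → ((λ i → c ∧ f i) · g) n ≡ c ∧ (f · g) n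
  ·-scaleˡ true  f g n = refl
  ·-scaleˡ false f g n = ·-zeroˡ g n

  -- The recursion of `_·_` splits the left factor; its mirror image, which splits the right one,
  -- reduces commutativity to an induction.
  ·-coeff-sucʳ : ∀ f g n → (f · g) (suc n) ≡ (f (suc n) ∧ g 0) xor (f · g ∘ suc) n
  ·-coeff-sucʳ f g zero    = xor-comm (f 0 ∧ g 1) (f 1 ∧ g 0)
  ·-coeff-sucʳ f g (suc n)
    rewrite ·-coeff-sucʳ (f ∘ suc) g n =
    solve 3 (λ a b c → a :+ (b :+ c) := b :+ (a :+ c)) refl
      (f 0 ∧ g (suc (suc n))) (f (suc (suc n)) ∧ g 0) ((f ∘ suc · g ∘ suc) n)
    where open xor-∧-Solver

  ·-comm : ∀ f g → f · g ≗ g · f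
  ·-comm f g zero    = ∧-comm (f 0) (g 0)
  ·-comm f g (suc n) =
    trans (cong₂ _xor_ (∧-comm (f 0) (g (suc n))) (·-comm (f ∘ suc) g n)) (sym (·-coeff-sucʳ g f n))

  -- Coefficient n of a product sees only coefficients up to n, which makes multiplication respect
  -- congruence modulo q^N.
  ·-local : ∀ {f f′ g g′} n → (∀ {i} → i ≤ n → f i ≡ f′ i) → (∀ {i} → i ≤ n → g i ≡ g′ i) →
            (f · g) n ≡ (f′ · g′) n
  ·-local zero    f≡ g≡ = cong₂ _∧_ (f≡ z≤n) (g≡ z≤n)
  ·-local (suc n) f≡ g≡ = cong₂ _xor_ (cong₂ _∧_ (f≡ z≤n) (g≡ ℕₚ.≤-refl))
    (·-local n (λ i≤n → f≡ (s≤s i≤n)) (λ i≤n → g≡ (ℕₚ.m≤n⇒m≤1+n i≤n)))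

  ·-assoc : ∀ f g h → f · g · h ≗ f · (g · h)
  ·-assoc f g h zero    = ∧-assoc (f 0) (g 0) (h 0)
  ·-assoc f g h (suc n)
    rewrite ·-distribʳ-⊕ h (λ i → f 0 ∧ g (suc i)) (f ∘ suc · g) n
          | ·-scaleˡ (f 0) (g ∘ suc) h n
          | ·-assoc (f ∘ suc) g h n =
    solve 5 (λ a b c x y → (a :* b) :* c :+ (a :* x :+ y) := a :* (b :* c :+ x) :+ y) refl
      (f 0) (g 0) (h (suc n)) ((g ∘ suc · h) n) ((f ∘ suc · (g · h)) n)
    where open xor-∧-Solver

  ·-identityʳ : ∀ f → f · 𝟙 ≗ f
  ·-identityʳ f n = trans (·-comm f 𝟙 n) (·-identityˡ f n)

  ·-distribˡ-⊕ : ∀ h f g → h · (f ⊕ g) ≗ h · f ⊕ h · g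
  ·-distribˡ-⊕ h f g n = trans (·-comm h (f ⊕ g) n)
    (trans (·-distribʳ-⊕ h f g n) (cong₂ _xor_ (·-comm f h n) (·-comm g h n)))

  ⊕-assoc : ∀ f g h → f ⊕ g ⊕ h ≗ f ⊕ (g ⊕ h)
  ⊕-assoc f g h n = xor-assoc (f n) (g n) (h n)

  ⊕-comm : ∀ f g → f ⊕ g ≗ g ⊕ f
  ⊕-comm f g n = xor-comm (f n) (g n)

  ⊕-identityˡ-≗ : ∀ f → 𝟘 ⊕ f ≗ f
  ⊕-identityˡ-≗ f n = refl

  ⊕-identityʳ-≗ : ∀ f → f ⊕ 𝟘 ≗ f
  ⊕-identityʳ-≗ f n = xor-identityʳ (f n)

  ⊕-self : ∀ f → f ⊕ f ≗ 𝟘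
  ⊕-self f n = xor-same (f n)

-- Congruence of series modulo q^N

infix 4 _≈[_]_

record _≈[_]_ (f : 𝔽₂⟦q⟧) (N : ℕ) (g : 𝔽₂⟦q⟧) : Set where
  constructor mk≈
  field coeff : ∀ {n} → n < N → f n ≡ g n

open _≈[_]_ public

pointwise : ∀ {f g} → f ≗ g → ∀ {N} → f ≈[ N ] g
pointwise eq = mk≈ λ {n} _ → eq n

𝔽₂⟦q⟧/q^ : ℕ → CommutativeRing 0ℓ 0ℓ
𝔽₂⟦q⟧/q^ N = record
  { Carrier = 𝔽₂⟦q⟧ ; _≈_ = _≈[ N ]_ ; _+_ = _⊕_ ; _*_ = _·_ ; -_ = id ; 0# = 𝟘 ; 1# = 𝟙
  ; isCommutativeRing = record
    { isRing = record
      { +-isAbelianGroup = record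
        { isGroup = record
          { isMonoid = record
            { isSemigroup = record
              { isMagma = record
                { isEquivalence = record
                  { refl  = mk≈ λ _ → refl
                  ; sym   = λ f≈g → mk≈ λ n<N → sym (coeff f≈g n<N)
                  ; trans = λ f≈g g≈h → mk≈ λ n<N → trans (coeff f≈g n<N) (coeff g≈h n<N)
                  }
                ; ∙-cong = λ {f} {f′} {g} {g′} f≈f′ g≈g′ → mk≈ λ {n} n<N → trans (coeff-⊕ f g n)
                    (trans (cong₂ _xor_ (coeff f≈f′ n<N) (coeff g≈g′ n<N)) (sym (coeff-⊕ f′ g′ n)))
                }
              ; assoc = λ f g h → pointwise (⊕-assoc f g h)
              }
            ; identity = (λ f → pointwise (⊕-identityˡ-≗ f)) , (λ f → pointwise (⊕-identityʳ-≗ f))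
            }
          ; inverse = (λ f → pointwise (⊕-self f)) , (λ f → pointwise (⊕-self f))
          ; ⁻¹-cong = id
          }
        ; comm = λ f g → pointwise (⊕-comm f g)
        }
      ; *-cong = λ f≈f′ g≈g′ → mk≈ λ {n} n<N → ·-local n
          (λ i≤n → coeff f≈f′ (ℕₚ.≤-<-trans i≤n n<N)) (λ i≤n → coeff g≈g′ (ℕₚ.≤-<-trans i≤n n<N))
      ; *-assoc = λ f g h → pointwise (·-assoc f g h)
      ; *-identity = (λ f → pointwise (·-identityˡ f)) , (λ f → pointwise (·-identityʳ f))
      ; distrib = (λ h f g → pointwise (·-distribˡ-⊕ h f g)) , (λ h f g → pointwise (·-distribʳ-⊕ h f g))
      }
    ; *-comm = λ f g → pointwise (·-comm f g)
    }
  }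

module _ {N : ℕ} where
  open CommutativeRing (𝔽₂⟦q⟧/q^ N) public
    using (setoid; zeroˡ; zeroʳ)
    renaming ( refl to ≈-refl; sym to ≈-sym; trans to ≈-trans; reflexive to ≈-reflexive
             ; +-cong to ⊕-cong; +-congˡ to ⊕-congˡ; +-congʳ to ⊕-congʳ
             ; +-identityˡ to ⊕-identityˡ; +-identityʳ to ⊕-identityʳ
             ; *-cong to ·-cong; *-congˡ to ·-congˡ; *-congʳ to ·-congʳ
             ; *-identityˡ to 𝟙·_; *-identityʳ to _·𝟙; distribˡ to ·-⊕-distribˡ; distribʳ to ·-⊕-distribʳ )

-- With coefficients in 𝔽₂ the ring solver knows that x + x = 0.
module 𝔽₂-Solver {N : ℕ} where

  private
    R : AlmostCommutativeRing 0ℓ 0ℓ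
    R = fromCommutativeRing (𝔽₂⟦q⟧/q^ N)

    const : Bool → 𝔽₂⟦q⟧
    const true  = 𝟙
    const false = 𝟘

    morphism : CommutativeRing.rawRing xor-∧-commutativeRing -Raw-AlmostCommutative⟶ R
    morphism = record
      { ⟦_⟧    = const
      ; +-homo = λ where
          true  true  → ≈-sym (pointwise (⊕-self 𝟙))
          true  false → ≈-sym (⊕-identityʳ 𝟙)
          false _     → ≈-sym (⊕-identityˡ _)
      ; *-homo = λ where
          true  y → ≈-sym (𝟙· const y)
          false y → ≈-sym (zeroˡ (const y))
      ; -‿homo = λ _ → ≈-refl
      ; 0-homo = ≈-refl
      ; 1-homo = ≈-refl
      }

    _≟const_ : ∀ a b → Maybe (const a ≈[ N ] const b)
    true  ≟const true  = just ≈-refl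
    false ≟const false = just ≈-refl
    _     ≟const _     = nothing

  open Algebra.Solver.Ring _ R morphism _≟const_ public using (solve; _:+_; _:*_; _:=_; con)

opaque
  unfolding _⊕_

  q^-+ : ∀ a b {N} → q^ a · q^ b ≈[ N ] q^ (a ℕ.+ b)
  q^-+ zero    b = 𝟙· (q^ b)
  q^-+ (suc a) b = pointwise λ
    { zero    → refl
    ; (suc n) → coeff (q^-+ a b) (ℕₚ.n<1+n n) }

-- The Jacobi triple product

module ≈-Reasoning {N : ℕ} = Relation.Binary.Reasoning.Setoid (setoid {N})

-- A series with constant term 1 is invertible: the lowest nonzero coefficient of `g ⊕ h` would
-- reappear in `f · (g ⊕ h)`. Division of series takes this form throughout.
unit-cancel : ∀ {N} f {g h} → f 0 ≡ true → f · g ≈[ N ] f · h → g ≈[ N ] h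
unit-cancel {N} f {g} {h} f₀ fg≈fh = mk≈ λ {n} n<N → xor-false (trans (sym (coeff-⊕ g h n)) (below n n<N ℕₚ.≤-refl))
  where
  xor-false : ∀ {x y} → x xor y ≡ false → x ≡ y
  xor-false {true}  {true}  _ = refl
  xor-false {false} {false} _ = refl

  d = g ⊕ h

  fd≈𝟘 : f · d ≈[ N ] 𝟘
  fd≈𝟘 = begin
    f · (g ⊕ h)      ≈⟨ ·-⊕-distribˡ f g h ⟩
    f · g ⊕ f · h    ≈⟨ ⊕-congʳ fg≈fh ⟩
    f · h ⊕ f · h    ≈⟨ solve 1 (λ x → x :+ x := con false) ≈-refl (f · h) ⟩
    𝟘                ∎
    where open ≈-Reasoning
          open 𝔽₂-Solver

  below : ∀ n → n < N → ∀ {i} → i ≤ n → d i ≡ false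
  below zero    n<N z≤n = begin
    d 0                ≡⟨ cong (_∧ d 0) f₀ ⟨
    f 0 ∧ d 0          ≡⟨ ·-coeff-zero f d ⟨
    (f · d) 0          ≡⟨ coeff fd≈𝟘 n<N ⟩
    𝟘 0                ≡⟨ coeff-𝟘 0 ⟩
    false              ∎
    where open ≡-Reasoning
  below (suc n) n<N {i} i≤n with ℕₚ.m≤n⇒m<n∨m≡n i≤n
  ... | inj₁ (s≤s i≤n′) = below n (ℕₚ.<-trans (ℕₚ.n<1+n n) n<N) i≤n′
  ... | inj₂ refl = begin
    d (suc n)                                   ≡⟨ xor-identityʳ _ ⟨
    d (suc n) xor false                         ≡⟨ cong₂ (λ x y → (x ∧ d (suc n)) xor y) f₀ tail≡0 ⟨
    (f 0 ∧ d (suc n)) xor (f ∘ suc · d) n       ≡⟨ ·-coeff-suc f d n ⟨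
    (f · d) (suc n)                             ≡⟨ coeff fd≈𝟘 n<N ⟩
    𝟘 (suc n)                                   ≡⟨ coeff-𝟘 (suc n) ⟩
    false                                       ∎
    where
    open ≡-Reasoning
    tail≡0 : (f ∘ suc · d) n ≡ false
    tail≡0 = begin
      (f ∘ suc · d) n ≡⟨ ·-local n (λ _ → refl) (λ i≤n → trans (below n (ℕₚ.<-trans (ℕₚ.n<1+n n) n<N) i≤n) (sym (coeff-𝟘 _))) ⟩
      (f ∘ suc · 𝟘) n ≡⟨ ·-comm (f ∘ suc) 𝟘 n ⟩
      (𝟘 · f ∘ suc) n ≡⟨ ·-zeroˡ (f ∘ suc) n ⟩
      𝟘 n             ≡⟨ coeff-𝟘 n ⟩
      false           ∎

q^-≈𝟘 : ∀ {L e} → L ≤ e → q^ e ≈[ L ] 𝟘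
q^-≈𝟘 {L} {e} L≤e = mk≈ λ {n} n<L →
  trans (coeff-q^ e n) (trans (go n (ℕₚ.<-≤-trans n<L L≤e)) (sym (coeff-𝟘 n)))
  where
  go : ∀ n {e} → n < e → (e ≡ᵇ n) ≡ false
  go zero    (s≤s _)   = refl
  go (suc n) (s≤s n<e) = go n n<e

-- the q-Pochhammer symbol (q^a ; q^s)_M; signs are immaterial modulo 2
poch : ℕ → ℕ → ℕ → 𝔽₂⟦q⟧
poch a s zero    = 𝟙
poch a s (suc M) = (𝟙 ⊕ q^ (a ℕ.+ s ℕ.* M)) · poch a s M

poch-coeff₀ : ∀ {a} s M → 1 ≤ a → poch a s M 0 ≡ true
poch-coeff₀ s zero    1≤a = coeff-q^ 0 0
poch-coeff₀ {suc a} s (suc M) 1≤a = begin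
  ((𝟙 ⊕ q^ e) · poch (suc a) s M) 0  ≡⟨ ·-coeff-zero (𝟙 ⊕ q^ e) (poch (suc a) s M) ⟩
  (𝟙 ⊕ q^ e) 0 ∧ poch (suc a) s M 0  ≡⟨ cong₂ _∧_ (trans (coeff-⊕ 𝟙 (q^ e) 0) (cong₂ _xor_ (coeff-q^ 0 0) (coeff-q^ e 0))) (poch-coeff₀ s M 1≤a) ⟩
  true                               ∎
  where
  open ≡-Reasoning
  e = suc a ℕ.+ s ℕ.* M

poch-front : ∀ a s M {N} → poch a s (suc M) ≈[ N ] (𝟙 ⊕ q^ a) · poch (a ℕ.+ s) s M
poch-front a s zero    = ·-congʳ (⊕-congˡ (≈-reflexive (cong q^_ (trans (cong (a ℕ.+_) (ℕₚ.*-zeroʳ s)) (ℕₚ.+-identityʳ a)))))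
poch-front a s (suc M) = begin
  (𝟙 ⊕ q^ (a ℕ.+ s ℕ.* suc M)) · poch a s (suc M)
    ≈⟨ ·-cong (⊕-congˡ (≈-reflexive (cong q^_ (eq a s M)))) (poch-front a s M) ⟩
  (𝟙 ⊕ q^ (a ℕ.+ s ℕ.+ s ℕ.* M)) · ((𝟙 ⊕ q^ a) · poch (a ℕ.+ s) s M)
    ≈⟨ solve 3 (λ x y z → x :* (y :* z) := y :* (x :* z)) ≈-refl _ _ _ ⟩
  (𝟙 ⊕ q^ a) · poch (a ℕ.+ s) s (suc M) ∎
  where
  open ≈-Reasoning
  open 𝔽₂-Solver
  eq : ∀ a s M → a ℕ.+ s ℕ.* suc M ≡ a ℕ.+ s ℕ.+ s ℕ.* M
  eq = ℕ-Ring.solve-∀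

-- The factors that `poch a s M` has in addition carry exponents at least a + s M₀ ≥ L, so they are
-- 1 modulo q^L.
poch-truncate : ∀ {a s L M M₀} → L ≤ a ℕ.+ s ℕ.* M₀ → M₀ ≤ M → poch a s M ≈[ L ] poch a s M₀
poch-truncate {a} {s} {L} {M} {M₀} L≤ M₀≤M =
  subst (λ K → poch a s K ≈[ L ] poch a s M₀) (ℕₚ.m∸n+n≡m M₀≤M) (go (M ℕ.∸ M₀))
  where
  go : ∀ d → poch a s (d ℕ.+ M₀) ≈[ L ] poch a s M₀
  go zero    = ≈-refl
  go (suc d) = begin
    (𝟙 ⊕ q^ (a ℕ.+ s ℕ.* (d ℕ.+ M₀))) · poch a s (d ℕ.+ M₀) ≈⟨ ·-cong (⊕-congˡ (q^-≈𝟘 large)) (go d) ⟩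
    (𝟙 ⊕ 𝟘) · poch a s M₀                                     ≈⟨ solve 1 (λ x → (con true :+ con false) :* x := x) ≈-refl _ ⟩
    poch a s M₀                                               ∎
    where
    open ≈-Reasoning
    open 𝔽₂-Solver
    large : L ≤ a ℕ.+ s ℕ.* (d ℕ.+ M₀)
    large = ℕₚ.≤-trans L≤ (ℕₚ.+-monoʳ-≤ a (ℕₚ.*-monoʳ-≤ s (ℕₚ.m≤n+m M₀ d)))

poch-stable : ∀ {a s L M} → 1 ≤ s → L ≤ M → poch a s M ≈[ L ] poch a s L
poch-stable {a} {s} {L} 1≤s = poch-truncate (ℕₚ.≤-trans (ℕₚ.m≤n*m L s {{ℕ.>-nonZero 1≤s}}) (ℕₚ.m≤n+m _ a))

-- Finite sums, Gaussian binomials and the q-binomial theorem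

opaque

  Σ< : ℕ → (ℕ → 𝔽₂⟦q⟧) → 𝔽₂⟦q⟧
  Σ< zero    h = 𝟘
  Σ< (suc n) h = h 0 ⊕ Σ< n (h ∘ suc)
  Σ<-suc : ∀ {N} n h → Σ< (suc n) h ≈[ N ] h 0 ⊕ Σ< n (h ∘ suc)
  Σ<-suc n h = ≈-refl

  Σ<-zero : ∀ {N h} → Σ< 0 h ≈[ N ] 𝟘
  Σ<-zero = ≈-refl

  Σ<-cong : ∀ {N} n {h k} → (∀ {i} → i < n → h i ≈[ N ] k i) → Σ< n h ≈[ N ] Σ< n k
  Σ<-cong zero    h≈k = ≈-refl
  Σ<-cong (suc n) h≈k = ⊕-cong (h≈k (s≤s z≤n)) (Σ<-cong n (λ i<n → h≈k (s≤s i<n)))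

  Σ<-⊕ : ∀ {N} n h k → Σ< n (λ i → h i ⊕ k i) ≈[ N ] Σ< n h ⊕ Σ< n k
  Σ<-⊕ zero    h k = ≈-sym (⊕-identityˡ 𝟘)
  Σ<-⊕ (suc n) h k = ≈-trans (⊕-congˡ (Σ<-⊕ n (h ∘ suc) (k ∘ suc)))
    (solve 4 (λ a b x y → a :+ b :+ (x :+ y) := a :+ x :+ (b :+ y)) ≈-refl _ _ _ _)
    where open 𝔽₂-Solver

  Σ<-· : ∀ {N} n f h → Σ< n (λ i → f · h i) ≈[ N ] f · Σ< n h
  Σ<-· zero    f h = ≈-sym (zeroʳ f)
  Σ<-· (suc n) f h = ≈-trans (⊕-congˡ (Σ<-· n f (h ∘ suc))) (≈-sym (·-⊕-distribˡ f _ _))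

  Σ<-last : ∀ {N} n h → h n ≈[ N ] 𝟘 → Σ< (suc n) h ≈[ N ] Σ< n h
  Σ<-last zero    h hn≈𝟘 = ≈-trans (⊕-identityʳ _) hn≈𝟘
  Σ<-last (suc n) h hn≈𝟘 = ⊕-congˡ (Σ<-last n (h ∘ suc) hn≈𝟘)

-- the Gaussian binomial coefficient in base q^s, modulo 2
binom : ℕ → ℕ → ℕ → 𝔽₂⟦q⟧
binom s N       zero    = 𝟙
binom s zero    (suc k) = 𝟘
binom s (suc N) (suc k) = binom s N k ⊕ q^ (s ℕ.* suc k) · binom s N (suc k)

binom-> : ∀ s {N k M} → N < k → binom s N k ≈[ M ] 𝟘
binom-> s {zero}  {suc k} _         = ≈-refl
binom-> s {suc N} {suc k} (s≤s N<k) = ≈-trans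
  (⊕-cong (binom-> s N<k) (·-congˡ (binom-> s (ℕₚ.m≤n⇒m≤1+n N<k)))) (≈-trans (⊕-identityˡ _) (zeroʳ _))

binom-diag : ∀ s N {M} → binom s N N ≈[ M ] 𝟙
binom-diag s zero    = ≈-refl
binom-diag s (suc N) = ≈-trans
  (⊕-cong (binom-diag s N) (≈-trans (·-congˡ (binom-> s (ℕₚ.n<1+n N))) (zeroʳ _))) (⊕-identityʳ _)

-- The factorial formula for Gaussian binomials, cleared of denominators. Pascal's rule leaves (1 +
-- Qk) + Qk (1 + Qd) = 1 + Qd Qk, the last factor of the longer Pochhammer symbol.
binom-poch : ∀ s d k {M} → binom s (d ℕ.+ k) k · (poch s s d · poch s s k) ≈[ M ] poch s s (d ℕ.+ k)
binom-poch s d zero rewrite ℕₚ.+-identityʳ d = solve 1 (λ x → con true :* (x :* con true) := x) ≈-refl _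
  where open 𝔽₂-Solver
binom-poch s zero (suc k) = ≈-trans (·-congʳ (binom-diag s (suc k)))
  (solve 1 (λ x → con true :* (con true :* x) := x) ≈-refl _)
  where open 𝔽₂-Solver
binom-poch s (suc d) (suc k) {M} = begin
  (A ⊕ q^ (s ℕ.* suc k) · B) · ((𝟙 ⊕ Qd) · Fd · ((𝟙 ⊕ Qk) · Fk))
    ≈⟨ ·-congʳ (⊕-congˡ (·-congʳ (≈-reflexive (cong q^_ (ℕₚ.*-suc s k))))) ⟩
  (A ⊕ Qk · B) · ((𝟙 ⊕ Qd) · Fd · ((𝟙 ⊕ Qk) · Fk))
    ≈⟨ solve 6 (λ A B x y u v → (A :+ y :* B) :* ((con true :+ x) :* u :* ((con true :+ y) :* v)) :=
         (con true :+ y) :* (A :* ((con true :+ x) :* u :* v)) :+ y :* (con true :+ x) :* (B :* (u :* ((con true :+ y) :* v))))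
         ≈-refl A B Qd Qk Fd Fk ⟩
  (𝟙 ⊕ Qk) · (A · ((𝟙 ⊕ Qd) · Fd · Fk)) ⊕ Qk · (𝟙 ⊕ Qd) · (B · (Fd · ((𝟙 ⊕ Qk) · Fk)))
    ≈⟨ ⊕-cong (·-congˡ ihA) (·-congˡ (binom-poch s d (suc k))) ⟩
  (𝟙 ⊕ Qk) · X ⊕ Qk · (𝟙 ⊕ Qd) · X
    ≈⟨ solve 3 (λ x y z → (con true :+ y) :* z :+ y :* (con true :+ x) :* z := (con true :+ x :* y) :* z) ≈-refl Qd Qk X ⟩
  (𝟙 ⊕ Qd · Qk) · X
    ≈⟨ ·-congʳ (⊕-congˡ (≈-trans (q^-+ _ _) (≈-reflexive (cong q^_ (eq s d k))))) ⟩
  (𝟙 ⊕ q^ (s ℕ.+ s ℕ.* (d ℕ.+ suc k))) · X ∎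
  where
  open ≈-Reasoning
  open 𝔽₂-Solver
  A  = binom s (d ℕ.+ suc k) k
  B  = binom s (d ℕ.+ suc k) (suc k)
  Fd = poch s s d
  Fk = poch s s k
  Qd = q^ (s ℕ.+ s ℕ.* d)
  Qk = q^ (s ℕ.+ s ℕ.* k)
  X  = poch s s (d ℕ.+ suc k)
  eq : ∀ s d k → s ℕ.+ s ℕ.* d ℕ.+ (s ℕ.+ s ℕ.* k) ≡ s ℕ.+ s ℕ.* (d ℕ.+ suc k)
  eq = ℕ-Ring.solve-∀
  ihA : A · ((𝟙 ⊕ Qd) · Fd · Fk) ≈[ M ] X
  ihA = subst (λ N → binom s N k · ((𝟙 ⊕ Qd) · Fd · Fk) ≈[ M ] poch s s N) (sym (ℕₚ.+-suc d k)) (binom-poch s (suc d) k)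

-- Drives the two inductions below: when x k = q^(e k) with e quadratic in k and leading coefficient
-- s / 2, one of the two sums is a monomial times the other.
pascal-sum : ∀ s N (x : ℕ → 𝔽₂⟦q⟧) {M} → Σ< (suc (suc N)) (λ k → binom s (suc N) k · x k) ≈[ M ]
  Σ< (suc N) (λ k → binom s N k · x (suc k)) ⊕ Σ< (suc N) (λ k → binom s N k · (q^ (s ℕ.* k) · x k))
pascal-sum s N x = begin
  Σ< (suc (suc N)) (λ k → binom s (suc N) k · x k)
    ≈⟨ Σ<-suc (suc N) _ ⟩
  𝟙 · x 0 ⊕ Σ< (suc N) (λ k → (binom s N k ⊕ q^ (s ℕ.* suc k) · binom s N (suc k)) · x (suc k))
    ≈⟨ ⊕-cong first (≈-trans (Σ<-cong (suc N) (λ {k} _ → split k)) (Σ<-⊕ (suc N) (λ k → binom s N k · x (suc k)) (T ∘ suc))) ⟩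
  T 0 ⊕ (S ⊕ Σ< (suc N) (T ∘ suc))
    ≈⟨ solve 3 (λ a b c → a :+ (b :+ c) := b :+ (a :+ c)) ≈-refl _ _ _ ⟩
  S ⊕ (T 0 ⊕ Σ< (suc N) (T ∘ suc))
    ≈⟨ ⊕-congˡ (Σ<-suc (suc N) T) ⟨
  S ⊕ Σ< (suc (suc N)) T
    ≈⟨ ⊕-congˡ (Σ<-last (suc N) T (≈-trans (·-congʳ (binom-> s (ℕₚ.n<1+n N))) (zeroˡ _))) ⟩
  S ⊕ Σ< (suc N) T ∎
  where
  open ≈-Reasoning
  open 𝔽₂-Solver
  S = Σ< (suc N) (λ k → binom s N k · x (suc k))
  T : ℕ → 𝔽₂⟦q⟧
  T k = binom s N k · (q^ (s ℕ.* k) · x k)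
  first : 𝟙 · x 0 ≈[ _ ] T 0
  first = ·-congˡ (≈-trans (≈-sym (𝟙· x 0)) (·-congʳ (≈-reflexive (cong q^_ (sym (ℕₚ.*-zeroʳ s))))))
  split : ∀ k → (binom s N k ⊕ q^ (s ℕ.* suc k) · binom s N (suc k)) · x (suc k) ≈[ _ ]
                binom s N k · x (suc k) ⊕ T (suc k)
  split k = solve 4 (λ a b c d → (a :+ b :* c) :* d := a :* d :+ c :* (b :* d)) ≈-refl _ _ _ _

-- s k(k-1)/2 + a k
quad : ℕ → ℕ → ℕ → ℕ
quad s a zero    = 0
quad s a (suc k) = quad s a k ℕ.+ (a ℕ.+ s ℕ.* k)

quad-+ : ∀ s a k → quad s (a ℕ.+ s) k ≡ s ℕ.* k ℕ.+ quad s a k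
quad-+ s a zero    = sym (trans (ℕₚ.+-identityʳ _) (ℕₚ.*-zeroʳ s))
quad-+ s a (suc k) rewrite quad-+ s a k = eq s a k (quad s a k)
  where
  eq : ∀ s a k x → s ℕ.* k ℕ.+ x ℕ.+ (a ℕ.+ s ℕ.+ s ℕ.* k) ≡ s ℕ.* suc k ℕ.+ (x ℕ.+ (a ℕ.+ s ℕ.* k))
  eq = ℕ-Ring.solve-∀

quad-≥ : ∀ s {a} k → 1 ≤ a → k ≤ quad s a k
quad-≥ s zero    1≤a = z≤n
quad-≥ s {a} (suc k) 1≤a = subst (ℕ._≤ quad s a (suc k)) (ℕₚ.+-comm k 1)
  (ℕₚ.+-mono-≤ (quad-≥ s k 1≤a) (ℕₚ.≤-trans 1≤a (ℕₚ.m≤m+n a (s ℕ.* k))))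

-- Both sums from Pascal's rule are the sum for a + s, one of them times q^a; the common factor 1 +
-- q^a is the first factor of the product.
binomial-theorem : ∀ s a m {M} → Σ< (suc m) (λ k → binom s m k · q^ quad s a k) ≈[ M ] poch a s m
binomial-theorem s a zero    = ≈-trans (Σ<-suc 0 (λ k → binom s 0 k · q^ quad s a k)) (≈-trans (⊕-congˡ Σ<-zero) (solve 0 (con true :* con true :+ con false := con true) ≈-refl))
  where open 𝔽₂-Solver
binomial-theorem s a (suc m) = begin
  Σ< (suc (suc m)) (λ k → binom s (suc m) k · q^ quad s a k)
    ≈⟨ pascal-sum s m (q^_ ∘ quad s a) ⟩
  Σ< (suc m) (λ k → binom s m k · q^ quad s a (suc k)) ⊕ Σ< (suc m) (λ k → binom s m k · (q^ (s ℕ.* k) · q^ quad s a k))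
    ≈⟨ ⊕-cong (≈-trans (Σ<-cong (suc m) (λ {k} _ → up k)) (Σ<-· (suc m) (q^ a) (λ k → binom s m k · q^ quad s (a ℕ.+ s) k))) (Σ<-cong (suc m) (λ {k} _ → ·-congˡ (≈-trans (q^-+ (s ℕ.* k) _) (≈-reflexive (cong q^_ (sym (quad-+ s a k))))))) ⟩
  q^ a · S ⊕ S
    ≈⟨ solve 2 (λ x y → x :* y :+ y := (con true :+ x) :* y) ≈-refl (q^ a) S ⟩
  (𝟙 ⊕ q^ a) · S
    ≈⟨ ·-congˡ (binomial-theorem s (a ℕ.+ s) m) ⟩
  (𝟙 ⊕ q^ a) · poch (a ℕ.+ s) s m
    ≈⟨ poch-front a s m ⟨
  poch a s (suc m) ∎
  where
  open ≈-Reasoning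
  open 𝔽₂-Solver
  S = Σ< (suc m) (λ k → binom s m k · q^ quad s (a ℕ.+ s) k)
  eq : ∀ a s k x → x ℕ.+ (a ℕ.+ s ℕ.* k) ≡ a ℕ.+ (s ℕ.* k ℕ.+ x)
  eq = ℕ-Ring.solve-∀
  up : ∀ k → binom s m k · q^ quad s a (suc k) ≈[ _ ] q^ a · (binom s m k · q^ quad s (a ℕ.+ s) k)
  up k = begin
    binom s m k · q^ quad s a (suc k)
      ≈⟨ ·-congˡ (≈-trans (≈-reflexive (cong q^_ (trans (eq a s k (quad s a k)) (cong (a ℕ.+_) (sym (quad-+ s a k)))))) (≈-sym (q^-+ a _))) ⟩
    binom s m k · (q^ a · q^ quad s (a ℕ.+ s) k)
      ≈⟨ solve 3 (λ x y z → x :* (y :* z) := y :* (x :* z)) ≈-refl _ _ _ ⟩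
    q^ a · (binom s m k · q^ quad s (a ℕ.+ s) k) ∎

-- Theta series as products

module Theta (s a b : ℕ) (a+b≡s : a ℕ.+ b ≡ s) where

  -- s j(j-1)/2 + a j; for j = -k this is s k(k-1)/2 + b k, since a + b = s
  exponent : ℤ → ℕ
  exponent (+ k)    = quad s a k
  exponent -[1+ k ] = quad s b (suc k)

  -- For j = k - n the exponents at j and j - 1 differ by s (j - 1) + a. Since s - a = b, adding s k
  -- to the one at j - 1 exceeds the one at j by b + s n, whatever k is.
  exponent-shift : ∀ k n → s ℕ.* k ℕ.+ exponent (k ⊖ suc n) ≡ b ℕ.+ s ℕ.* n ℕ.+ exponent (k ⊖ n)
  exponent-shift zero    zero    = eq s b
    where
    eq : ∀ s b → s ℕ.* 0 ℕ.+ (0 ℕ.+ (b ℕ.+ s ℕ.* 0)) ≡ b ℕ.+ s ℕ.* 0 ℕ.+ 0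
    eq = ℕ-Ring.solve-∀
  exponent-shift zero    (suc n) = eq s b n (quad s b n ℕ.+ (b ℕ.+ s ℕ.* n))
    where
    eq : ∀ s b n x → s ℕ.* 0 ℕ.+ (x ℕ.+ (b ℕ.+ s ℕ.* suc n)) ≡ b ℕ.+ s ℕ.* suc n ℕ.+ x
    eq = ℕ-Ring.solve-∀
  exponent-shift (suc k) zero    rewrite sym a+b≡s = eq a b k (quad (a ℕ.+ b) a k)
    where
    eq : ∀ a b k x → (a ℕ.+ b) ℕ.* suc k ℕ.+ x ≡ b ℕ.+ (a ℕ.+ b) ℕ.* 0 ℕ.+ (x ℕ.+ (a ℕ.+ (a ℕ.+ b) ℕ.* k))
    eq = ℕ-Ring.solve-∀
  exponent-shift (suc k) (suc n)
    rewrite ℤₚ.[1+m]⊖[1+n]≡m⊖n k (suc n) | ℤₚ.[1+m]⊖[1+n]≡m⊖n k n | ℕₚ.*-suc s k | ℕₚ.*-suc s n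
          | ℕₚ.+-assoc s (s ℕ.* k) (exponent (k ⊖ suc n)) | exponent-shift k n =
    eq s b (s ℕ.* n) (exponent (k ⊖ n))
    where
    eq : ∀ s b n x → s ℕ.+ (b ℕ.+ n ℕ.+ x) ≡ b ℕ.+ (s ℕ.+ n) ℕ.+ x
    eq = ℕ-Ring.solve-∀

  -- Grows from the q-binomial theorem at n = 0: each step moves the summation range one place to
  -- the left and contributes the factor 1 + q^(b + s n).
  finite-triple-product : ∀ m n {M} → Σ< (suc (n ℕ.+ m)) (λ k → binom s (n ℕ.+ m) k · q^ exponent (k ⊖ n)) ≈[ M ]
    poch a s m · poch b s n
  finite-triple-product m zero = ≈-trans (binomial-theorem s a m) (≈-sym (_ ·𝟙))
  finite-triple-product m (suc n) = begin
    Σ< (suc (suc (n ℕ.+ m))) (λ k → binom s (suc (n ℕ.+ m)) k · q^ exponent (k ⊖ suc n))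
      ≈⟨ pascal-sum s (n ℕ.+ m) (λ k → q^ exponent (k ⊖ suc n)) ⟩
    Σ< (suc (n ℕ.+ m)) (λ k → binom s (n ℕ.+ m) k · q^ exponent (suc k ⊖ suc n)) ⊕
    Σ< (suc (n ℕ.+ m)) (λ k → binom s (n ℕ.+ m) k · (q^ (s ℕ.* k) · q^ exponent (k ⊖ suc n)))
      ≈⟨ ⊕-cong (Σ<-cong (suc (n ℕ.+ m)) (λ {k} _ → ·-congˡ (≈-reflexive (cong (q^_ ∘ exponent) (ℤₚ.[1+m]⊖[1+n]≡m⊖n k n)))))
                (≈-trans (Σ<-cong (suc (n ℕ.+ m)) (λ {k} _ → down k)) (Σ<-· (suc (n ℕ.+ m)) (q^ (b ℕ.+ s ℕ.* n)) (λ k → binom s (n ℕ.+ m) k · q^ exponent (k ⊖ n)))) ⟩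
    S ⊕ q^ (b ℕ.+ s ℕ.* n) · S
      ≈⟨ ⊕-cong (finite-triple-product m n) (·-congˡ (finite-triple-product m n)) ⟩
    poch a s m · poch b s n ⊕ q^ (b ℕ.+ s ℕ.* n) · (poch a s m · poch b s n)
      ≈⟨ solve 3 (λ x y z → x :* y :+ z :* (x :* y) := x :* ((con true :+ z) :* y)) ≈-refl _ _ _ ⟩
    poch a s m · poch b s (suc n) ∎
    where
    open ≈-Reasoning
    open 𝔽₂-Solver
    S = Σ< (suc (n ℕ.+ m)) (λ k → binom s (n ℕ.+ m) k · q^ exponent (k ⊖ n))
    down : ∀ k → binom s (n ℕ.+ m) k · (q^ (s ℕ.* k) · q^ exponent (k ⊖ suc n)) ≈[ _ ]
      q^ (b ℕ.+ s ℕ.* n) · (binom s (n ℕ.+ m) k · q^ exponent (k ⊖ n))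
    down k = begin
      binom s (n ℕ.+ m) k · (q^ (s ℕ.* k) · q^ exponent (k ⊖ suc n))
        ≈⟨ ·-congˡ (≈-trans (q^-+ (s ℕ.* k) _) (≈-trans (≈-reflexive (cong q^_ (exponent-shift k n))) (≈-sym (q^-+ (b ℕ.+ s ℕ.* n) _)))) ⟩
      binom s (n ℕ.+ m) k · (q^ (b ℕ.+ s ℕ.* n) · q^ exponent (k ⊖ n))
        ≈⟨ solve 3 (λ x y z → x :* (y :* z) := y :* (x :* z)) ≈-refl _ _ _ ⟩
      q^ (b ℕ.+ s ℕ.* n) · (binom s (n ℕ.+ m) k · q^ exponent (k ⊖ n)) ∎

  module _ (1≤a : 1 ≤ a) (1≤b : 1 ≤ b) where

    1≤s : 1 ≤ s
    1≤s = subst (1 ≤_) a+b≡s (ℕₚ.≤-trans 1≤a (ℕₚ.m≤m+n a b))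

    -- Leaves only |j| < L below q^L; it cuts the theta series to finite sums and later confines
    -- their index pairs to a box.
    exponent-≥ : ∀ j → ∣ j ∣ ≤ exponent j
    exponent-≥ (+ k)    = quad-≥ s k 1≤a
    exponent-≥ -[1+ k ] = quad-≥ s (suc k) 1≤b

    -- Below q^L the three Pochhammer symbols of the factorial formula all equal F, so that it reads
    -- F F B = F, and F cancels.
    binom-limit : ∀ {L} d k → L ≤ d → L ≤ k → poch s s L · binom s (d ℕ.+ k) k ≈[ L ] 𝟙
    binom-limit {L} d k L≤d L≤k = unit-cancel (poch s s L) (poch-coeff₀ s L 1≤s) (begin
      F · (F · B)                        ≈⟨ solve 2 (λ x y → x :* (x :* y) := y :* (x :* x)) ≈-refl F B ⟩
      B · (F · F)                        ≈⟨ ·-congˡ (·-cong (poch-stable 1≤s L≤d) (poch-stable 1≤s L≤k)) ⟨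
      B · (poch s s d · poch s s k)      ≈⟨ binom-poch s d k ⟩
      poch s s (d ℕ.+ k)                 ≈⟨ poch-stable 1≤s (ℕₚ.≤-trans L≤d (ℕₚ.m≤m+n d k)) ⟩
      F                                  ≈⟨ F ·𝟙 ⟨
      F · 𝟙                              ∎)
      where
      open ≈-Reasoning
      open 𝔽₂-Solver
      F = poch s s L
      B = binom s (d ℕ.+ k) k

    -- Why K = 2 L: an index k at distance less than L from an end of the range has |k - K| ≥ L, so
    -- its monomial vanishes; for any other index both k and 2 K - k are at least L, and
    -- `binom-limit` applies.
    triple-product : ∀ L → let K = L ℕ.+ L in
      poch s s K · (poch a s K · poch b s K) ≈[ L ] Σ< (suc (K ℕ.+ K)) (λ k → q^ exponent (k ⊖ K))
    triple-product L = begin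
      poch s s K · (poch a s K · poch b s K)
        ≈⟨ ·-cong (poch-stable 1≤s (ℕₚ.m≤m+n L L)) (≈-sym (finite-triple-product K K)) ⟩
      F · Σ< (suc (K ℕ.+ K)) (λ k → binom s (K ℕ.+ K) k · q^ exponent (k ⊖ K))
        ≈⟨ Σ<-· (suc (K ℕ.+ K)) F (λ k → binom s (K ℕ.+ K) k · q^ exponent (k ⊖ K)) ⟨
      Σ< (suc (K ℕ.+ K)) (λ k → F · (binom s (K ℕ.+ K) k · q^ exponent (k ⊖ K)))
        ≈⟨ Σ<-cong (suc (K ℕ.+ K)) (λ {k} k< → term k (ℕₚ.≤-pred k<)) ⟩
      Σ< (suc (K ℕ.+ K)) (λ k → q^ exponent (k ⊖ K)) ∎
      where
      open ≈-Reasoning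
      open 𝔽₂-Solver
      K = L ℕ.+ L
      F = poch s s L
      vanish : ∀ {k} → L ≤ ∣ k ⊖ K ∣ → F · (binom s (K ℕ.+ K) k · q^ exponent (k ⊖ K)) ≈[ L ] q^ exponent (k ⊖ K)
      vanish {k} L≤ = ≈-trans (·-congˡ (≈-trans (·-congˡ e≈𝟘) (zeroʳ _))) (≈-trans (zeroʳ _) (≈-sym e≈𝟘))
        where e≈𝟘 = q^-≈𝟘 (ℕₚ.≤-trans L≤ (exponent-≥ (k ⊖ K)))
      term : ∀ k → k ≤ K ℕ.+ K → F · (binom s (K ℕ.+ K) k · q^ exponent (k ⊖ K)) ≈[ L ] q^ exponent (k ⊖ K)
      term k k≤ with k <? L | K ℕ.+ K ℕ.∸ k <? L
      ... | yes k<L | _ = vanish {k} (subst (L ≤_) (sym (ℤₚ.∣⊖∣-≤ (ℕₚ.≤-trans (ℕₚ.<⇒≤ k<L) (ℕₚ.m≤m+n L L))))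
        (ℕₚ.≤-trans (ℕₚ.≤-reflexive (sym (ℕₚ.m+n∸n≡m L L))) (ℕₚ.∸-monoʳ-≤ K (ℕₚ.<⇒≤ k<L))))
      ... | no _ | yes d<L = vanish {k} (subst (L ≤_) (sym (trans (ℤₚ.∣m⊖n∣≡∣n⊖m∣ k K) (ℤₚ.∣⊖∣-≤ K≤k)))
        (ℕₚ.+-cancelʳ-≤ K L (k ℕ.∸ K) (subst (L ℕ.+ K ≤_) (sym (ℕₚ.m∸n+n≡m K≤k)) L+K≤k)))
        where
        L+K≤k : L ℕ.+ K ≤ k
        L+K≤k = ℕₚ.+-cancelˡ-≤ L (L ℕ.+ K) k (ℕₚ.≤-trans (ℕₚ.≤-reflexive (sym (ℕₚ.+-assoc L L K)))
          (ℕₚ.≤-trans (ℕₚ.≤-reflexive (sym (ℕₚ.m∸n+n≡m k≤))) (ℕₚ.+-monoˡ-≤ k (ℕₚ.<⇒≤ d<L))))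
        K≤k : K ≤ k
        K≤k = ℕₚ.≤-trans (ℕₚ.m≤n+m K L) L+K≤k
      ... | no k≮L | no d≮L = begin
        F · (binom s (K ℕ.+ K) k · x) ≈⟨ solve 3 (λ x y z → x :* (y :* z) := x :* y :* z) ≈-refl F _ x ⟩
        F · binom s (K ℕ.+ K) k · x   ≡⟨ cong (λ N → F · binom s N k · x) (ℕₚ.m∸n+n≡m k≤) ⟨
        F · binom s (d ℕ.+ k) k · x   ≈⟨ ·-congʳ (binom-limit d k (ℕₚ.≮⇒≥ d≮L) (ℕₚ.≮⇒≥ k≮L)) ⟩
        𝟙 · x                         ≈⟨ 𝟙· x ⟩
        x                             ∎
        where
        x = q^ exponent (k ⊖ K)
        d = K ℕ.+ K ℕ.∸ k

-- Parities of finite counts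

⨁ : {A : Set} → (A → Bool) → List A → Bool
⨁ f []       = false
⨁ f (x ∷ xs) = f x xor ⨁ f xs

⨁-cong : {A : Set} {f g : A → Bool} → f ≗ g → ⨁ f ≗ ⨁ g
⨁-cong f≗g []       = refl
⨁-cong f≗g (x ∷ xs) = cong₂ _xor_ (f≗g x) (⨁-cong f≗g xs)

⨁-xor : {A : Set} (f g : A → Bool) → ∀ xs → ⨁ (λ x → f x xor g x) xs ≡ ⨁ f xs xor ⨁ g xs
⨁-xor f g []       = refl
⨁-xor f g (x ∷ xs) rewrite ⨁-xor f g xs =
  solve 4 (λ a b c d → (a :+ b) :+ (c :+ d) := (a :+ c) :+ (b :+ d)) refl (f x) (g x) (⨁ f xs) (⨁ g xs)
  where open xor-∧-Solver

parity : {A : Set} {P : Pred A 0ℓ} → Decidable P → List A → Bool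
parity P? = ⨁ (does ∘ P?)

odd : ℕ → Bool
odd zero    = false
odd (suc n) = not (odd n)

parity≡odd : {A : Set} {P : Pred A 0ℓ} (P? : Decidable P) → ∀ xs → parity P? xs ≡ odd (length (filter P? xs))
parity≡odd P? []       = refl
parity≡odd P? (x ∷ xs) with does (P? x)
... | true  = cong not (parity≡odd P? xs)
... | false = parity≡odd P? xs

parity-xor : {A : Set} {P Q R : Pred A 0ℓ} (P? : Decidable P) (Q? : Decidable Q) (R? : Decidable R) →
             (∀ x → does (P? x) ≡ does (Q? x) xor does (R? x)) → ∀ xs →
             parity P? xs ≡ parity Q? xs xor parity R? xs
parity-xor P? Q? R? eq xs = trans (⨁-cong eq xs) (⨁-xor (does ∘ Q?) (does ∘ R?) xs)

-- Repetition-free lists with the same members are permutations of each other. The lists xs and ys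
-- are windows wide enough to hold all solutions, so φ compares the full solution sets.
parity-reindex : {A B : Set} {P : Pred A 0ℓ} {Q : Pred B 0ℓ} (P? : Decidable P) (Q? : Decidable Q)
  {xs : List A} {ys : List B} → Unique xs → Unique ys →
  (φ : A → B) → (∀ {a a′} → φ a ≡ φ a′ → a ≡ a′) →
  (∀ {a} → P a → Q (φ a)) → (∀ {b} → Q b → b ∈ ys) → (∀ {b} → Q b → ∃ λ a → a ∈ xs × P a × φ a ≡ b) →
  parity P? xs ≡ parity Q? ys
parity-reindex {Q = Q} P? Q? {xs} {ys} xs! ys! φ φ-inj P⇒Q Q⇒∈ lift = begin
  parity P? xs                        ≡⟨ parity≡odd P? xs ⟩
  odd (length (filter P? xs))         ≡⟨ cong odd (length-map φ (filter P? xs)) ⟨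
  odd (length (map φ (filter P? xs))) ≡⟨ cong odd (↭-length (∼bag⇒↭ same)) ⟩
  odd (length (filter Q? ys))         ≡⟨ parity≡odd Q? ys ⟨
  parity Q? ys                        ∎
  where
  open ≡-Reasoning
  to : ∀ {b} → b ∈ map φ (filter P? xs) → b ∈ filter Q? ys
  to b∈ with _ , a∈ , refl ← ∈-map⁻ φ b∈ =
    ∈-filter⁺ Q? (Q⇒∈ q) q
    where q = P⇒Q (proj₂ (∈-filter⁻ P? {xs = xs} a∈))
  from : ∀ {b} → b ∈ filter Q? ys → b ∈ map φ (filter P? xs)
  from b∈ with _ , a∈ , p , refl ← lift (proj₂ (∈-filter⁻ Q? {xs = ys} b∈)) = ∈-map⁺ φ (∈-filter⁺ P? a∈ p)
  same = unique∧set⇒bag (Unique.map⁺ φ-inj (Unique.filter⁺ P? xs!)) (Unique.filter⁺ Q? ys!) (mk⇔ to from)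

-- Enumerates -K, ..., K exactly as the theta sums do, through `k ⊖ K`.
interval : ℕ → List ℤ
interval K = applyUpTo (_⊖ K) (suc (K ℕ.+ K))

interval! : ∀ K → Unique (interval K)
interval! K = Unique.applyUpTo⁺₁ (_⊖ K) _ λ {i} {j} i<j _ eq → ℕₚ.<⇒≢ i<j (ℤₚ.+-injective (begin
  + i                ≡⟨ un i ⟩
  (i ⊖ K) + + K      ≡⟨ cong (_+ + K) eq ⟩
  (j ⊖ K) + + K      ≡⟨ un j ⟨
  + j                ∎))
  where
  open ≡-Reasoning
  cancel : ∀ x y → x ≡ x - y + y
  cancel = ℤ-Ring.solve-∀
  un : ∀ i → + i ≡ (i ⊖ K) + + K
  un i = trans (cancel (+ i) (+ K)) (cong (_+ + K) (ℤₚ.m-n≡m⊖n i K))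

∈-interval : ∀ {K x} → ∣ x ∣ ≤ K → x ∈ interval K
∈-interval {K} {+ k} k≤K = subst (_∈ interval K)
  (trans (ℤₚ.≤-⊖ (ℕₚ.m≤n+m K k)) (cong +_ (ℕₚ.m+n∸n≡m k K)))
  (∈-applyUpTo⁺ (_⊖ K) (s≤s (ℕₚ.+-monoˡ-≤ K k≤K)))
∈-interval {K} { -[1+ k ]} k<K = subst (_∈ interval K)
  (trans (ℤₚ.⊖-≤ (ℕₚ.m∸n≤m K (suc k))) (cong (λ x → - (+ x)) (ℕₚ.m∸[m∸n]≡n k<K)))
  (∈-applyUpTo⁺ (_⊖ K) (s≤s (ℕₚ.≤-trans (ℕₚ.m∸n≤m K (suc k)) (ℕₚ.m≤m+n K K))))

box : ℕ → List (ℤ × ℤ)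
box K = cartesianProduct (interval K) (interval K)

box! : ∀ K → Unique (box K)
box! K = Unique.cartesianProduct⁺ (interval! K) (interval! K)

∈-box : ∀ {K x y} → ∣ x ∣ ≤ K → ∣ y ∣ ≤ K → (x , y) ∈ box K
∈-box x≤ y≤ = ∈-cartesianProduct⁺ (∈-interval x≤) (∈-interval y≤)

∣x∣≤x² : ∀ x → ∣ x ∣ ≤ ∣ x * x ∣
∣x∣≤x² (+ zero)    = z≤n
∣x∣≤x² x@(+ suc k)  = subst (suc k ≤_) (sym (ℤₚ.abs-* x x)) (ℕₚ.m≤m*n (suc k) (suc k))
∣x∣≤x² x@(-[1+ k ]) = subst (suc k ≤_) (sym (ℤₚ.abs-* x x)) (ℕₚ.m≤m*n (suc k) (suc k))

+∣x*x∣ : ∀ x → + ∣ x * x ∣ ≡ x * x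
+∣x*x∣ (+ zero)   = refl
+∣x*x∣ (+ suc k)  = refl
+∣x*x∣ -[1+ k ]   = refl

two-squares-bound : ∀ x y {m} → x * x + y * y ≡ + m → ∣ x ∣ ≤ m × ∣ y ∣ ≤ m
two-squares-bound x y {m} eq =
  ℕₚ.≤-trans (∣x∣≤x² x) (subst (∣ x * x ∣ ≤_) sum≡ (ℕₚ.m≤m+n _ _)) ,
  ℕₚ.≤-trans (∣x∣≤x² y) (subst (∣ y * y ∣ ≤_) sum≡ (ℕₚ.m≤n+m _ _))
  where
  sum≡ : ∣ x * x ∣ ℕ.+ ∣ y * y ∣ ≡ m
  sum≡ = ℤₚ.+-injective (trans (cong₂ _+_ (+∣x*x∣ x) (+∣x*x∣ y)) eq)

-- The involution y ↦ - y pairs off the points with y ≠ 0.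
parity-even : {P : Pred (ℤ × ℤ) 0ℓ} (P? : Decidable P) (K : ℕ) →
  (∀ {x y} → P (x , y) → P (x , - y)) → (∀ {x y} → P (x , y) → ∣ x ∣ ≤ K × ∣ y ∣ ≤ K) →
  parity P? (box K) ≡ parity (λ x → P? (x , + 0)) (interval K)
parity-even {P} P? K even bound = begin
  parity P? (box K)
    ≡⟨ parity-xor P? on? off? (λ { (x , y) → split x y }) (box K) ⟩
  parity on? (box K) xor parity off? (box K)
    ≡⟨ cong (parity on? (box K) xor_) (parity-xor off? pos? neg? (λ { (x , y) → sign x y }) (box K)) ⟩
  parity on? (box K) xor (parity pos? (box K) xor parity neg? (box K))
    ≡⟨ cong (λ b → parity on? (box K) xor (b xor parity neg? (box K))) mirror ⟩
  parity on? (box K) xor (parity neg? (box K) xor parity neg? (box K))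
    ≡⟨ cong (parity on? (box K) xor_) (xor-same (parity neg? (box K))) ⟩
  parity on? (box K) xor false
    ≡⟨ xor-identityʳ (parity on? (box K)) ⟩
  parity on? (box K)
    ≡⟨ parity-reindex (λ x → P? (x , + 0)) on? (interval! K) (box! K) (_, + 0) (cong proj₁)
         (λ p → p , refl) (λ (p , _) → inside p) (λ { {x , y} (p , refl) → x , ∈-interval (proj₁ (bound p)) , p , refl }) ⟨
  parity (λ x → P? (x , + 0)) (interval K) ∎
  where
  open ≡-Reasoning
  inside : ∀ {z} → P z → z ∈ box K
  inside p = ∈-box (proj₁ (bound p)) (proj₂ (bound p))
  on? : Decidable (λ z → P z × proj₂ z ≡ + 0)
  on? z = P? z ×-dec (proj₂ z ≟ + 0)
  pos? : Decidable (λ z → P z × + 0 ℤ.< proj₂ z)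
  pos? z = P? z ×-dec (+ 0 ℤ.<? proj₂ z)
  neg? : Decidable (λ z → P z × proj₂ z ℤ.< + 0)
  neg? z = P? z ×-dec (proj₂ z ℤ.<? + 0)
  off? : Decidable (λ z → P z × proj₂ z ≢ + 0)
  off? z = P? z ×-dec ¬-dec (proj₂ z)
    where
    open import Relation.Nullary using (¬?)
    ¬-dec : ∀ y → Dec (y ≢ + 0)
    ¬-dec y = ¬? (y ≟ + 0)
  split : ∀ x y → does (P? (x , y)) ≡ does (on? (x , y)) xor does (off? (x , y))
  split x y with does (P? (x , y)) | does (y ≟ + 0)
  ... | false | _     = refl
  ... | true  | true  = refl
  ... | true  | false = refl
  sign : ∀ x y → does (off? (x , y)) ≡ does (pos? (x , y)) xor does (neg? (x , y))
  sign x (+ zero)  with does (P? (x , + 0))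
  ... | true  = refl
  ... | false = refl
  sign x (+ suc k) with does (P? (x , + suc k))
  ... | true  = refl
  ... | false = refl
  sign x -[1+ k ] with does (P? (x , -[1+ k ]))
  ... | true  = refl
  ... | false = refl
  mirror : parity pos? (box K) ≡ parity neg? (box K)
  mirror = parity-reindex pos? neg? (box! K) (box! K) (λ (x , y) → x , - y)
    (λ eq → cong₂ _,_ (cong proj₁ eq) (ℤₚ.neg-injective (cong proj₂ eq)))
    (λ (p , 0<y) → even p , ℤₚ.neg-mono-< 0<y) (λ (p , _) → inside p)
    (λ { {x , y} (p , y<0) → (x , - y) , inside (even p) , (even p , ℤₚ.neg-mono-< y<0) , cong (x ,_) (ℤₚ.neg-involutive y) })

-- Gaussian integers of norm 4 n + 1

-- Each later congruence is certified by explicit multipliers u and z, which leaves a polynomial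
-- identity to the ring solver.
∣-linear : ∀ {d x y} u z → d ℤ∣.∣ x → y ≡ u * x + z * d → d ℤ∣.∣ y
∣-linear {d} u z d∣x refl = ℤ∣.∣m∣n⇒∣m+n (ℤ∣.∣n⇒∣m*n u d∣x) (divides z refl)

∣-shift : ∀ d x y z → y ≡ x + z * d → does (d ∣? x) ≡ does (d ∣? y)
∣-shift d x y z refl = does-⇔ (mk⇔ (λ p → ∣-linear (+ 1) z p (there x z d))
  (λ p → ∣-linear (+ 1) (- z) p (back x z d))) (d ∣? x) (d ∣? y)
  where
  there : ∀ x z d → x + z * d ≡ + 1 * x + z * d
  there = ℤ-Ring.solve-∀
  back : ∀ x z d → x ≡ + 1 * (x + z * d) + - z * d
  back = ℤ-Ring.solve-∀

-- The five shifts form a complete residue system, so exactly one test succeeds. The shifts 1, -2,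
-- -1, 2 stand for the levels -1, 2, 1, -2, in the order of the units 1, i, -1, -i that carry these
-- levels to -1.
classes-mod-5 : ∀ x → does (+ 5 ∣? x) xor (does (+ 5 ∣? (x + + 1)) xor (does (+ 5 ∣? (x - + 2)) xor
  (does (+ 5 ∣? (x - + 1)) xor does (+ 5 ∣? (x + + 2))))) ≡ true
classes-mod-5 x = trans
  (cong₂ _xor_ (shift₀ (x /ℕ 5)) (cong₂ _xor_ (shift (+ 1)) (cong₂ _xor_ (shift (- + 2)) (cong₂ _xor_ (shift (- + 1)) (shift (+ 2))))))
  (cases (x %ℕ 5) (n%ℕd<d x 5))
  where
  shift₀ : ∀ q → does (+ 5 ∣? x) ≡ does (+ 5 ∣? + (x %ℕ 5))
  shift₀ q = sym (∣-shift (+ 5) (+ (x %ℕ 5)) x (x /ℕ 5) (a≡a%ℕn+[a/ℕn]*n x 5))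
  shift : ∀ c → does (+ 5 ∣? (x + c)) ≡ does (+ 5 ∣? (+ (x %ℕ 5) + c))
  shift c = sym (∣-shift (+ 5) (+ (x %ℕ 5) + c) (x + c) (x /ℕ 5)
    (trans (cong (_+ c) (a≡a%ℕn+[a/ℕn]*n x 5)) (comm (+ (x %ℕ 5)) (x /ℕ 5) c)))
    where
    comm : ∀ r q c → r + q * + 5 + c ≡ r + c + q * + 5
    comm = ℤ-Ring.solve-∀
  cases : ∀ r → r < 5 → does (+ 5 ∣? + r) xor (does (+ 5 ∣? (+ r + + 1)) xor (does (+ 5 ∣? (+ r - + 2)) xor
    (does (+ 5 ∣? (+ r - + 1)) xor does (+ 5 ∣? (+ r + + 2))))) ≡ true
  cases 0 _ = refl
  cases 1 _ = refl
  cases 2 _ = refl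
  cases 3 _ = refl
  cases 4 _ = refl
  cases (suc (suc (suc (suc (suc _))))) (s≤s (s≤s (s≤s (s≤s (s≤s ())))))

-- A sum of two squares that is 1 modulo 4 has exactly one odd term, and that term's root is 1 or -1
-- modulo 4: exactly one test succeeds.
classes-mod-4 : ∀ s t n → s * s + t * t ≡ + 4 * n + + 1 →
  does (+ 4 ∣? (s - + 1)) xor (does (+ 4 ∣? (t - + 1)) xor (does (+ 4 ∣? (s + + 1)) xor does (+ 4 ∣? (t + + 1)))) ≡ true
classes-mod-4 s t n eq = trans
  (cong₂ _xor_ (shift s (- + 1)) (cong₂ _xor_ (shift t (- + 1)) (cong₂ _xor_ (shift s (+ 1)) (shift t (+ 1)))))
  (cases (s %ℕ 4) (t %ℕ 4) (n%ℕd<d s 4) (n%ℕd<d t 4) odd-norm)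
  where
  shift : ∀ x c → does (+ 4 ∣? (x + c)) ≡ does (+ 4 ∣? (+ (x %ℕ 4) + c))
  shift x c = sym (∣-shift (+ 4) (+ (x %ℕ 4) + c) (x + c) (x /ℕ 4)
    (trans (cong (_+ c) (a≡a%ℕn+[a/ℕn]*n x 4)) (comm (+ (x %ℕ 4)) (x /ℕ 4) c)))
    where
    comm : ∀ r q c → r + q * + 4 + c ≡ r + c + q * + 4
    comm = ℤ-Ring.solve-∀
  odd-norm : + 4 ℤ∣.∣ + (s %ℕ 4) * + (s %ℕ 4) + + (t %ℕ 4) * + (t %ℕ 4) - + 1
  odd-norm = divides (n - z r₁ q₁ - z r₂ q₂) (trans (split r₁ q₁ r₂ q₂) (trans (cong (λ x → x - + 1 - (z r₁ q₁ + z r₂ q₂) * + 4)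
    (trans (sym (cong₂ (λ x y → x * x + y * y) (a≡a%ℕn+[a/ℕn]*n s 4) (a≡a%ℕn+[a/ℕn]*n t 4))) eq)) (collect n (z r₁ q₁) (z r₂ q₂))))
    where
    r₁ = + (s %ℕ 4)
    q₁ = s /ℕ 4
    r₂ = + (t %ℕ 4)
    q₂ = t /ℕ 4
    z : ℤ → ℤ → ℤ
    z r q = + 2 * r * q + + 4 * q * q
    split : ∀ r₁ q₁ r₂ q₂ → r₁ * r₁ + r₂ * r₂ - + 1 ≡
      (r₁ + q₁ * + 4) * (r₁ + q₁ * + 4) + (r₂ + q₂ * + 4) * (r₂ + q₂ * + 4) - + 1
        - ((+ 2 * r₁ * q₁ + + 4 * q₁ * q₁) + (+ 2 * r₂ * q₂ + + 4 * q₂ * q₂)) * + 4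
    split = ℤ-Ring.solve-∀
    collect : ∀ n z₁ z₂ → + 4 * n + + 1 - + 1 - (z₁ + z₂) * + 4 ≡ (n - z₁ - z₂) * + 4
    collect = ℤ-Ring.solve-∀
  refute : ∀ {z b} → + 4 ℤ∣.∣ z → does (+ 4 ∣? z) ≡ false → b ≡ true
  refute {z} p ∤ = contradiction (trans (sym (dec-true (+ 4 ∣? z) p)) ∤) λ ()
  cases : ∀ r r′ → r < 4 → r′ < 4 → + 4 ℤ∣.∣ + r * + r + + r′ * + r′ - + 1 →
    does (+ 4 ∣? (+ r - + 1)) xor (does (+ 4 ∣? (+ r′ - + 1)) xor (does (+ 4 ∣? (+ r + + 1)) xor does (+ 4 ∣? (+ r′ + + 1)))) ≡ true
  cases 0 1 _ _ _ = refl
  cases 0 3 _ _ _ = refl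
  cases 1 0 _ _ _ = refl
  cases 1 2 _ _ _ = refl
  cases 2 1 _ _ _ = refl
  cases 2 3 _ _ _ = refl
  cases 3 0 _ _ _ = refl
  cases 3 2 _ _ _ = refl
  -- Residues of equal parity give r² + r′² - 1 ≡ -1 or 1 (mod 4).
  cases 0 0 _ _ p = refute p refl
  cases 0 2 _ _ p = refute p refl
  cases 1 1 _ _ p = refute p refl
  cases 1 3 _ _ p = refute p refl
  cases 2 0 _ _ p = refute p refl
  cases 2 2 _ _ p = refute p refl
  cases 3 1 _ _ p = refute p refl
  cases 3 3 _ _ p = refute p refl
  cases (suc (suc (suc (suc _)))) _ (s≤s (s≤s (s≤s (s≤s ())))) _ _
  cases 0 (suc (suc (suc (suc _)))) _ (s≤s (s≤s (s≤s (s≤s ())))) _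
  cases 1 (suc (suc (suc (suc _)))) _ (s≤s (s≤s (s≤s (s≤s ())))) _
  cases 2 (suc (suc (suc (suc _)))) _ (s≤s (s≤s (s≤s (s≤s ())))) _
  cases 3 (suc (suc (suc (suc _)))) _ (s≤s (s≤s (s≤s (s≤s ())))) _

quad-closed : ∀ s a k → + 2 * + quad s a k ≡ + s * (+ k * + k - + k) + + 2 * + a * + k
quad-closed s a zero    = base (+ s) (+ a)
  where
  base : ∀ s a → + 0 ≡ s * + 0 + + 2 * a * + 0
  base = ℤ-Ring.solve-∀
quad-closed s a (suc k) = begin
  + 2 * (+ quad s a k + (+ a + + (s ℕ.* k)))
    ≡⟨ cong (λ x → + 2 * (+ quad s a k + (+ a + x))) (ℤₚ.pos-* s k) ⟩
  + 2 * (+ quad s a k + (+ a + + s * + k))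
    ≡⟨ ℤₚ.*-distribˡ-+ (+ 2) (+ quad s a k) _ ⟩
  + 2 * + quad s a k + + 2 * (+ a + + s * + k)
    ≡⟨ cong (_+ + 2 * (+ a + + s * + k)) (quad-closed s a k) ⟩
  + s * (+ k * + k - + k) + + 2 * + a * + k + + 2 * (+ a + + s * + k)
    ≡⟨ step (+ s) (+ a) (+ k) ⟩
  + s * (+ suc k * + suc k - + suc k) + + 2 * + a * + suc k ∎
  where
  open ≡-Reasoning
  step : ∀ s a k → s * (k * k - k) + + 2 * a * k + + 2 * (a + s * k) ≡
    s * ((+ 1 + k) * (+ 1 + k) - (+ 1 + k)) + + 2 * a * (+ 1 + k)
  step = ℤ-Ring.solve-∀

exponent-closed : ∀ {s a b} (a+b≡s : a ℕ.+ b ≡ s) j →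
  + 2 * + Theta.exponent s a b a+b≡s j ≡ + s * (j * j - j) + + 2 * + a * j
exponent-closed {s} {a} a+b≡s (+ k) = quad-closed s a k
exponent-closed {_} {a} {b} refl -[1+ k ] = trans (quad-closed (a ℕ.+ b) b (suc k)) (flip (+ a) (+ b) (+ suc k))
  where
  flip : ∀ a b m → (a + b) * (m * m - m) + + 2 * b * m ≡ (a + b) * (- m * - m - - m) + + 2 * a * - m
  flip = ℤ-Ring.solve-∀

module Lattice (n : ℕ) where

  N : ℤ
  N = + 4 * + n + + 1

  -- Coordinates satisfy |s|, |t| ≤ s² + t², so the box of this radius holds all points of norm N.
  bound : ℕ
  bound = 4 ℕ.* n ℕ.+ 1

  N≡bound : N ≡ + bound
  N≡bound = cong (_+ + 1) (sym (ℤₚ.pos-* 4 n))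

  Norm : ℤ × ℤ → Set
  Norm (s , t) = s * s + t * t ≡ N

  norm? : Decidable Norm
  norm? (s , t) = s * s + t * t ≟ N

  norm-∈ : ∀ {z} → Norm z → z ∈ box bound
  norm-∈ {s , t} eq = ∈-box (proj₁ bounds) (proj₂ bounds)
    where bounds = two-squares-bound s t (trans eq N≡bound)

  One-mod-4 : ℤ × ℤ → Set
  One-mod-4 z = Norm z × + 4 ℤ∣.∣ proj₁ z - + 1

  one-mod-4? : Decidable One-mod-4
  one-mod-4? z = norm? z ×-dec (+ 4 ∣? (proj₁ z - + 1))

  -- Modulo 5 this is the ring homomorphism from ℤ[i] to 𝔽₅ with i ↦ 2, whose kernel is generated by
  -- 1 + 2 i.
  level : ℤ × ℤ → ℤ
  level (s , t) = s + + 2 * t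

  rotate : {P Q : Pred (ℤ × ℤ) 0ℓ} (P? : Decidable P) (Q? : Decidable Q) (φ ψ : ℤ × ℤ → ℤ × ℤ) →
    (∀ z → φ (ψ z) ≡ z) → (∀ z → ψ (φ z) ≡ z) → (∀ {z} → P z → Norm z) → (∀ {z} → Q z → Norm z) →
    (∀ {z} → P z → Q (φ z)) → (∀ {z} → Q z → P (ψ z)) →
    parity P? (box bound) ≡ parity Q? (box bound)
  rotate P? Q? φ ψ φψ ψφ P⇒norm Q⇒norm P⇒Q Q⇒P =
    parity-reindex P? Q? (box! bound) (box! bound) φ
      (λ {a} {b} eq → trans (sym (ψφ a)) (trans (cong ψ eq) (ψφ b)))
      P⇒Q (norm-∈ ∘ Q⇒norm) (λ {z} q → ψ z , norm-∈ (P⇒norm (Q⇒P q)) , Q⇒P q , φψ z)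

  i· -i· -1· : ℤ × ℤ → ℤ × ℤ
  i·  (s , t) = - t , s
  -i· (s , t) = t , - s
  -1· (s , t) = - s , - t

  i·-i· : ∀ z → i· (-i· z) ≡ z
  i·-i· (s , t) = cong (_, t) (ℤₚ.neg-involutive s)

  -i·i· : ∀ z → -i· (i· z) ≡ z
  -i·i· (s , t) = cong (s ,_) (ℤₚ.neg-involutive t)

  -1·-1· : ∀ z → -1· (-1· z) ≡ z
  -1·-1· (s , t) = cong₂ _,_ (ℤₚ.neg-involutive s) (ℤₚ.neg-involutive t)

  norm-i· : ∀ {z} → Norm z → Norm (i· z)
  norm-i· {s , t} eq = trans (rearrange s t) eq
    where
    rearrange : ∀ s t → - t * - t + s * s ≡ s * s + t * t
    rearrange = ℤ-Ring.solve-∀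

  norm--i· : ∀ {z} → Norm z → Norm (-i· z)
  norm--i· {s , t} eq = trans (rearrange s t) eq
    where
    rearrange : ∀ s t → t * t + - s * - s ≡ s * s + t * t
    rearrange = ℤ-Ring.solve-∀

  norm--1· : ∀ {z} → Norm z → Norm (-1· z)
  norm--1· {s , t} eq = trans (rearrange s t) eq
    where
    rearrange : ∀ s t → - s * - s + - t * - t ≡ s * s + t * t
    rearrange = ℤ-Ring.solve-∀

  Primary : ℤ × ℤ → Set
  Primary z = Norm z × + 5 ℤ∣.∣ level z + + 1

  primary? : Decidable Primary
  primary? z = norm? z ×-dec (+ 5 ∣? (level z + + 1))

  -- The points normalised modulo 4 that have level -c modulo 5; the values c = 1, -2, -1, 2 cover
  -- the nonzero levels, and `V` is level 0.
  W : ℤ → ℤ × ℤ → Set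
  W c z = One-mod-4 z × + 5 ℤ∣.∣ level z + c

  W? : ∀ c → Decidable (W c)
  W? c z = one-mod-4? z ×-dec (+ 5 ∣? (level z + c))

  V : ℤ × ℤ → Set
  V z = One-mod-4 z × + 5 ℤ∣.∣ level z

  V? : Decidable V
  V? z = one-mod-4? z ×-dec (+ 5 ∣? level z)

  -- Multiplication by i multiplies s + 2 t by 2 modulo 5, so among the four associates of s + i t
  -- with s + 2 t prime to 5 exactly one has s + 2 t ≡ -1 (mod 5), and exactly one has s ≡ 1 (mod 4).
  primary≡ : parity primary? (box bound) ≡ parity one-mod-4? (box bound) xor parity V? (box bound)
  primary≡ = begin
    parity primary? sq
      ≡⟨ ⨁-cong split-4 sq ⟩
    ⨁ (λ z → does (A₀? z) xor (does (A₁? z) xor (does (A₂? z) xor does (A₃? z)))) sq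
      ≡⟨ expand (does ∘ A₀?) (does ∘ A₁?) (does ∘ A₂?) (does ∘ A₃?) ⟩
    parity A₀? sq xor (parity A₁? sq xor (parity A₂? sq xor parity A₃? sq))
      -- The units 1, i, -1, -i bring the four levels to -1 and turn s ≡ 1 into s ≡ 1, t ≡ 1, s ≡
      -- -1, t ≡ -1 (mod 4) respectively.
      ≡⟨ cong₂ _xor_ rot₀ (cong₂ _xor_ rot₁ (cong₂ _xor_ rot₂ rot₃)) ⟨
    parity (W? (+ 1)) sq xor (parity (W? (- + 2)) sq xor (parity (W? (- + 1)) sq xor parity (W? (+ 2)) sq))
      ≡⟨ expand (does ∘ W? (+ 1)) (does ∘ W? (- + 2)) (does ∘ W? (- + 1)) (does ∘ W? (+ 2)) ⟨
    ⨁ (λ z → does (W? (+ 1) z) xor (does (W? (- + 2) z) xor (does (W? (- + 1) z) xor does (W? (+ 2) z)))) sq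
      -- Adding `V` modulo 2 removes level 0 from the normalised points, so the four nonzero levels
      -- remain.
      ≡⟨ ⨁-cong split-5 sq ⟨
    ⨁ (λ z → does (one-mod-4? z) xor does (V? z)) sq
      ≡⟨ ⨁-xor (does ∘ one-mod-4?) (does ∘ V?) sq ⟩
    parity one-mod-4? sq xor parity V? sq ∎
    where
    open ≡-Reasoning
    sq = box bound
    A₀? : Decidable (λ z → Primary z × + 4 ℤ∣.∣ proj₁ z - + 1)
    A₀? z = primary? z ×-dec (+ 4 ∣? (proj₁ z - + 1))
    A₁? : Decidable (λ z → Primary z × + 4 ℤ∣.∣ proj₂ z - + 1)
    A₁? z = primary? z ×-dec (+ 4 ∣? (proj₂ z - + 1))
    A₂? : Decidable (λ z → Primary z × + 4 ℤ∣.∣ proj₁ z + + 1)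
    A₂? z = primary? z ×-dec (+ 4 ∣? (proj₁ z + + 1))
    A₃? : Decidable (λ z → Primary z × + 4 ℤ∣.∣ proj₂ z + + 1)
    A₃? z = primary? z ×-dec (+ 4 ∣? (proj₂ z + + 1))
    expand : ∀ f g h k → ⨁ (λ z → f z xor (g z xor (h z xor k z))) sq ≡ ⨁ f sq xor (⨁ g sq xor (⨁ h sq xor ⨁ k sq))
    expand f g h k = trans (⨁-xor f _ sq) (cong (⨁ f sq xor_) (trans (⨁-xor g _ sq) (cong (⨁ g sq xor_) (⨁-xor h k sq))))
    split-4 : ∀ z → does (primary? z) ≡ does (A₀? z) xor (does (A₁? z) xor (does (A₂? z) xor does (A₃? z)))
    split-4 z@(s , t) = guard (primary? z) _ _ _ _ (λ (eq , _) → classes-mod-4 s t (+ n) eq)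
      where
      guard : {P : Set} (P? : Dec P) → ∀ a b c d → (P → a xor (b xor (c xor d)) ≡ true) →
        does P? ≡ does P? ∧ a xor (does P? ∧ b xor (does P? ∧ c xor does P? ∧ d))
      guard (no _)  a b c d _   = refl
      guard (yes p) a b c d eq = sym (eq p)
    split-5 : ∀ z → does (one-mod-4? z) xor does (V? z) ≡
      does (W? (+ 1) z) xor (does (W? (- + 2) z) xor (does (W? (- + 1) z) xor does (W? (+ 2) z)))
    split-5 z = guard (does (one-mod-4? z)) _ _ _ _ _ (classes-mod-5 (level z))
      where
      guard : ∀ p v a b c d → v xor (a xor (b xor (c xor d))) ≡ true →
        p xor p ∧ v ≡ p ∧ a xor (p ∧ b xor (p ∧ c xor p ∧ d))
      guard false _     _ _ _ _ _  = refl
      guard true  true  a b c d eq = sym (trans (sym (not-involutive _)) (cong not eq))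
      guard true  false a b c d eq = sym eq
    rot₀ : parity (W? (+ 1)) sq ≡ parity A₀? sq
    rot₀ = rotate (W? (+ 1)) A₀? id id (λ _ → refl) (λ _ → refl) (proj₁ ∘ proj₁) (proj₁ ∘ proj₁)
      (λ { ((a , b) , c) → (a , c) , b }) (λ { ((a , b) , c) → (a , c) , b })
    rot₁ : parity (W? (- + 2)) sq ≡ parity A₁? sq
    rot₁ = rotate (W? (- + 2)) A₁? i· -i· i·-i· -i·i· (proj₁ ∘ proj₁) (proj₁ ∘ proj₁)
      (λ { {s , t} ((a , b) , c) → (norm-i· {s , t} a , ∣-linear (+ 2) (+ 1 - t) c (there s t)) , b })
      (λ { {s , t} ((a , b) , c) → (norm--i· {s , t} a , c) , ∣-linear (- + 2) t b (back s t) })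
      where
      there : ∀ s t → - t + + 2 * s + + 1 ≡ + 2 * (s + + 2 * t - + 2) + (+ 1 - t) * + 5
      there = ℤ-Ring.solve-∀
      back : ∀ s t → t + + 2 * - s - + 2 ≡ - + 2 * (s + + 2 * t + + 1) + t * + 5
      back = ℤ-Ring.solve-∀
    neg : ∀ c x → - x - c ≡ - + 1 * (x + c) + + 0 * + 4
    neg = ℤ-Ring.solve-∀
    rot₂ : parity (W? (- + 1)) sq ≡ parity A₂? sq
    rot₂ = rotate (W? (- + 1)) A₂? -1· -1· -1·-1· -1·-1· (proj₁ ∘ proj₁) (proj₁ ∘ proj₁)
      (λ { {s , t} ((a , b) , c) → (norm--1· {s , t} a , ∣-linear (- + 1) (+ 0) c (there s t)) ,
                                   ∣-linear (- + 1) (+ 0) b (neg (- + 1) s) })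
      (λ { {s , t} ((a , b) , c) → (norm--1· {s , t} a , ∣-linear (- + 1) (+ 0) c (neg (+ 1) s)) ,
                                   ∣-linear (- + 1) (+ 0) b (back s t) })
      where
      there : ∀ s t → - s + + 2 * - t + + 1 ≡ - + 1 * (s + + 2 * t - + 1) + + 0 * + 5
      there = ℤ-Ring.solve-∀
      back : ∀ s t → - s + + 2 * - t - + 1 ≡ - + 1 * (s + + 2 * t + + 1) + + 0 * + 5
      back = ℤ-Ring.solve-∀
    rot₃ : parity (W? (+ 2)) sq ≡ parity A₃? sq
    rot₃ = rotate (W? (+ 2)) A₃? -i· i· -i·i· i·-i· (proj₁ ∘ proj₁) (proj₁ ∘ proj₁)
      (λ { {s , t} ((a , b) , c) → (norm--i· {s , t} a , ∣-linear (- + 2) (t + + 1) c (there s t)) ,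
                                   ∣-linear (- + 1) (+ 0) b (neg (- + 1) s) })
      (λ { {s , t} ((a , b) , c) → (norm-i· {s , t} a , ∣-linear (- + 1) (+ 0) c (neg (+ 1) t)) ,
                                   ∣-linear (+ 2) (- t) b (back s t) })
      where
      there : ∀ s t → t + + 2 * - s + + 1 ≡ - + 2 * (s + + 2 * t + + 2) + (t + + 1) * + 5
      there = ℤ-Ring.solve-∀
      back : ∀ s t → - t + + 2 * s + + 2 ≡ + 2 * (s + + 2 * t + + 1) + - t * + 5
      back = ℤ-Ring.solve-∀

  -- The class condition constrains s alone and survives t ↦ - t, so only the points with t = 0
  -- count modulo 2.
  one-mod-4≡ : parity one-mod-4? (box bound) ≡
    parity (λ s → (s * s ≟ N) ×-dec (+ 4 ∣? (s - + 1))) (interval bound)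
  one-mod-4≡ = trans
    (parity-even one-mod-4? bound
      (λ { {s} {t} (eq , p) → norm--1·-snd s t eq , p })
      (λ { {s} {t} (eq , _) → two-squares-bound s t (trans eq N≡bound) }))
    (⨁-cong (λ s → cong (_∧ does (+ 4 ∣? (s - + 1))) (cong (λ x → does (x ≟ N)) (ℤₚ.+-identityʳ (s * s)))) (interval bound))
    where
    norm--1·-snd : ∀ s t → Norm (s , t) → Norm (s , - t)
    norm--1·-snd s t eq = trans (rearrange s t) eq
      where
      rearrange : ∀ s t → s * s + - t * - t ≡ s * s + t * t
      rearrange = ℤ-Ring.solve-∀

  five-bound : ∀ x y → + 5 * (x * x + y * y) ≡ N → ∣ x ∣ ≤ bound × ∣ y ∣ ≤ bound
  five-bound x y eq = ℕₚ.≤-trans (proj₁ bs) m≤ , ℕₚ.≤-trans (proj₂ bs) m≤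
    where
    m = ∣ x * x ∣ ℕ.+ ∣ y * y ∣
    m≡ : x * x + y * y ≡ + m
    m≡ = sym (cong₂ _+_ (+∣x*x∣ x) (+∣x*x∣ y))
    bs = two-squares-bound x y m≡
    m≤ : m ≤ bound
    m≤ = subst (m ≤_) (ℤₚ.+-injective (trans (ℤₚ.pos-* 5 m) (trans (cong (+ 5 *_) (sym m≡)) (trans eq N≡bound)))) (ℕₚ.m≤n*m m 5)

  -- 5 divides s + 2 t precisely when s + i t is a multiple (1 + 2 i)(x + i y)
  V≡ : parity V? (box bound) ≡
    parity (λ x → (+ 5 * (x * x) ≟ N) ×-dec (+ 4 ∣? (x - + 1))) (interval bound)
  V≡ = begin
    parity V? (box bound)
      ≡⟨ parity-reindex V′? V? (box! bound) (box! bound) φ φ-inj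
           (λ {z} → V′⇒V z) (λ {z} v → norm-∈ {z} (proj₁ (proj₁ v))) (λ {z} → lift z) ⟨
    parity V′? (box bound)
      ≡⟨ parity-even V′? bound (λ {x} {y} → mirror x y) (λ { {x} {y} (eq , _) → five-bound x y eq }) ⟩
    parity (λ x → V′? (x , + 0)) (interval bound)
      ≡⟨ ⨁-cong (λ x → cong₂ (λ a b → does (+ 5 * a ≟ N) ∧ does (+ 4 ∣? (b - + 1))) (ℤₚ.+-identityʳ (x * x)) (ℤₚ.+-identityʳ x)) (interval bound) ⟩
    parity (λ x → (+ 5 * (x * x) ≟ N) ×-dec (+ 4 ∣? (x - + 1))) (interval bound) ∎
    where
    open ≡-Reasoning
    φ : ℤ × ℤ → ℤ × ℤ
    φ (x , y) = x - + 2 * y , + 2 * x + y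
    V′ : ℤ × ℤ → Set
    V′ (x , y) = + 5 * (x * x + y * y) ≡ N × + 4 ℤ∣.∣ x - + 2 * y - + 1
    V′? : Decidable V′
    V′? (x , y) = (+ 5 * (x * x + y * y) ≟ N) ×-dec (+ 4 ∣? (x - + 2 * y - + 1))
    level-φ : ∀ x y → x - + 2 * y + + 2 * (+ 2 * x + y) ≡ x * + 5
    level-φ = ℤ-Ring.solve-∀
    norm-φ : ∀ x y → (x - + 2 * y) * (x - + 2 * y) + (+ 2 * x + y) * (+ 2 * x + y) ≡ + 5 * (x * x + y * y)
    norm-φ = ℤ-Ring.solve-∀
    φ-inj : ∀ {z w} → φ z ≡ φ w → z ≡ w
    φ-inj {x , y} {x′ , y′} eq = cong₂ _,_ x≡ y≡
      where
      x≡ : x ≡ x′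
      x≡ = ℤₚ.*-cancelʳ-≡ x x′ (+ 5) (trans (sym (level-φ x y)) (trans (cong level eq) (level-φ x′ y′)))
      y≡ : y ≡ y′
      y≡ = trans (recover x y) (trans (cong₂ (λ a b → b - + 2 * a) x≡ (cong proj₂ eq)) (sym (recover x′ y′)))
        where
        recover : ∀ x y → y ≡ + 2 * x + y - + 2 * x
        recover = ℤ-Ring.solve-∀
    V′⇒V : ∀ z → V′ z → V (φ z)
    V′⇒V (x , y) (eq , p) = (trans (norm-φ x y) eq , p) , divides x (level-φ x y)
    -- The values x - 2 y and x + 2 y differ by 4 y, so the condition modulo 4 does not see the sign
    -- of y.
    mirror : ∀ x y → V′ (x , y) → V′ (x , - y)
    mirror x y (eq , p) = trans (flip-norm x y) eq , ∣-linear (+ 1) y p (flip-class x y)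
      where
      flip-norm : ∀ x y → + 5 * (x * x + - y * - y) ≡ + 5 * (x * x + y * y)
      flip-norm = ℤ-Ring.solve-∀
      flip-class : ∀ x y → x - + 2 * - y - + 1 ≡ + 1 * (x - + 2 * y - + 1) + y * + 4
      flip-class = ℤ-Ring.solve-∀
    lift : ∀ z → V z → ∃ λ w → w ∈ box bound × V′ w × φ w ≡ z
    -- Division of s + i t by 1 + 2 i: `w` is the real part (s + 2 t) / 5, and t - 2 w equals the
    -- imaginary part (t - 2 s) / 5.
    lift (s , t) ((eq , p) , divides w level≡) =
      (w , t - + 2 * w) , ∈-box (proj₁ bs) (proj₂ bs) , (eq′ , subst (λ a → + 4 ℤ∣.∣ a - + 1) (sym fst) p) , cong₂ _,_ fst (snd t w)
      where
      fst : w - + 2 * (t - + 2 * w) ≡ s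
      fst = trans (collect w t) (trans (cong (_- + 2 * t) (sym level≡)) (cancel s t))
        where
        collect : ∀ w t → w - + 2 * (t - + 2 * w) ≡ w * + 5 - + 2 * t
        collect = ℤ-Ring.solve-∀
        cancel : ∀ s t → s + + 2 * t - + 2 * t ≡ s
        cancel = ℤ-Ring.solve-∀
      snd : ∀ t w → + 2 * w + (t - + 2 * w) ≡ t
      snd = ℤ-Ring.solve-∀
      eq′ : + 5 * (w * w + (t - + 2 * w) * (t - + 2 * w)) ≡ N
      eq′ = trans (sym (norm-φ w (t - + 2 * w))) (trans (cong₂ (λ a b → a * a + b * b) fst (snd t w)) eq)
      bs = five-bound w (t - + 2 * w) eq′


  -- Theta exponents as norms

  module Θ₁ = Theta 5 1 4 refl
  module Θ₂ = Theta 5 2 3 refl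
  -- `Ψ₁` and `Ψ₅` have exponents 2 j (2 j - 1) and 10 j (2 j - 1), those of E₂³ and E₁₀³: j (2 j -
  -- 1) runs through the triangular numbers as j runs through ℤ.
  module Ψ₁ = Theta 8 2 6 refl
  module Ψ₅ = Theta 40 10 30 refl

  N-injective : ∀ {m} → + 4 * + m + + 1 ≡ N → m ≡ n
  N-injective {m} eq = ℤₚ.+-injective (ℤₚ.*-cancelˡ-≡ (+ 4) (+ m) (+ n) (trans (strip (+ m)) (trans (cong (_- + 1) eq) (sym (strip (+ n))))))
    where
    strip : ∀ m → + 4 * m ≡ + 4 * m + + 1 - + 1
    strip = ℤ-Ring.solve-∀

  -- With x = 10 i - 3 and y = 10 j - 1 the exponents add up to n when x² + y² = 10 (4 n + 1);
  -- dividing x + y √-1 by 3 + √-1, of norm 10, gives the conjugate of the point on the right.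
  Θ-norm : ∀ i j → + 4 * + (Θ₁.exponent i ℕ.+ Θ₂.exponent j) + + 1 ≡
    (+ 3 * i + j - + 1) * (+ 3 * i + j - + 1) + (i - + 3 * j) * (i - + 3 * j)
  Θ-norm i j = trans (double (+ Θ₁.exponent i) (+ Θ₂.exponent j))
    (trans (cong₂ (λ x y → + 2 * x + + 2 * y + + 1) (exponent-closed refl i) (exponent-closed refl j)) (expand i j))
    where
    double : ∀ x y → + 4 * (x + y) + + 1 ≡ + 2 * (+ 2 * x) + + 2 * (+ 2 * y) + + 1
    double = ℤ-Ring.solve-∀
    expand : ∀ i j → + 2 * (+ 5 * (i * i - i) + + 2 * + 1 * i) + + 2 * (+ 5 * (j * j - j) + + 2 * + 2 * j) + + 1 ≡
      (+ 3 * i + j - + 1) * (+ 3 * i + j - + 1) + (i - + 3 * j) * (i - + 3 * j)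
    expand = ℤ-Ring.solve-∀

  -- Completes the square of 4 j² - 2 j. The root 1 - 4 j runs once through the integers that are 1
  -- modulo 4, the class left over by `one-mod-4≡`.
  Ψ₁-norm : ∀ j → + 4 * + Ψ₁.exponent j + + 1 ≡ (+ 1 - + 4 * j) * (+ 1 - + 4 * j)
  Ψ₁-norm j = trans (double (+ Ψ₁.exponent j)) (trans (cong (λ x → + 2 * x + + 1) (exponent-closed refl j)) (expand j))
    where
    double : ∀ x → + 4 * x + + 1 ≡ + 2 * (+ 2 * x) + + 1
    double = ℤ-Ring.solve-∀
    expand : ∀ j → + 2 * (+ 8 * (j * j - j) + + 2 * + 2 * j) + + 1 ≡ (+ 1 - + 4 * j) * (+ 1 - + 4 * j)
    expand = ℤ-Ring.solve-∀

  -- The factor q in front of E₁₀³ contributes the 4 that raises the constant term from 1 to 5 and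
  -- so makes the value five times a square.
  Ψ₅-norm : ∀ j → + 4 * + (1 ℕ.+ Ψ₅.exponent j) + + 1 ≡ + 5 * ((+ 1 - + 4 * j) * (+ 1 - + 4 * j))
  Ψ₅-norm j = trans (double (+ Ψ₅.exponent j)) (trans (cong (λ x → + 2 * x + + 5) (exponent-closed refl j)) (expand j))
    where
    double : ∀ x → + 4 * (+ 1 + x) + + 1 ≡ + 2 * (+ 2 * x) + + 5
    double = ℤ-Ring.solve-∀
    expand : ∀ j → + 2 * (+ 40 * (j * j - j) + + 2 * + 10 * j) + + 5 ≡ + 5 * ((+ 1 - + 4 * j) * (+ 1 - + 4 * j))
    expand = ℤ-Ring.solve-∀

  module _ {K : ℕ} (n≤K : n ≤ K) where

    ΘΘ? : Decidable (λ z → Θ₁.exponent (proj₁ z) ℕ.+ Θ₂.exponent (proj₂ z) ≡ n)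
    ΘΘ? z = Θ₁.exponent (proj₁ z) ℕ.+ Θ₂.exponent (proj₂ z) ℕ.≟ n

    -- `φ` hits every primary point: the level condition recovers i - j, and the oddness of the norm
    -- makes the remaining halving possible.
    ΘΘ≡ : parity ΘΘ? (box K) ≡ parity primary? (box bound)
    ΘΘ≡ = parity-reindex ΘΘ? primary? (box! K) (box! bound) φ φ-inj
      (λ {z} → to z) (λ {z} p → norm-∈ {z} (proj₁ p)) (λ {z} → from z)
      where
      φ : ℤ × ℤ → ℤ × ℤ
      φ (i , j) = + 3 * i + j - + 1 , i - + 3 * j
      φ-inj : ∀ {z w} → φ z ≡ φ w → z ≡ w
      φ-inj {i , j} {i′ , j′} eq = cong₂ _,_
        (ℤₚ.*-cancelˡ-≡ (+ 10) i i′ (trans (fst i j) (trans (cong (λ z → + 3 * (proj₁ z + + 1) + proj₂ z) eq) (sym (fst i′ j′)))))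
        (ℤₚ.*-cancelˡ-≡ (+ 10) j j′ (trans (snd i j) (trans (cong (λ z → proj₁ z + + 1 - + 3 * proj₂ z) eq) (sym (snd i′ j′)))))
        where
        fst : ∀ i j → + 10 * i ≡ + 3 * (+ 3 * i + j - + 1 + + 1) + (i - + 3 * j)
        fst = ℤ-Ring.solve-∀
        snd : ∀ i j → + 10 * j ≡ + 3 * i + j - + 1 + + 1 - + 3 * (i - + 3 * j)
        snd = ℤ-Ring.solve-∀
      to : ∀ z → Θ₁.exponent (proj₁ z) ℕ.+ Θ₂.exponent (proj₂ z) ≡ n → Primary (φ z)
      to (i , j) refl = sym (Θ-norm i j) , divides (i - j) (level-φ i j)
        where
        level-φ : ∀ i j → + 3 * i + j - + 1 + + 2 * (i - + 3 * j) + + 1 ≡ (i - j) * + 5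
        level-φ = ℤ-Ring.solve-∀
      from : ∀ z → Primary z → ∃ λ w → w ∈ box K × Θ₁.exponent (proj₁ w) ℕ.+ Θ₂.exponent (proj₂ w) ≡ n × φ w ≡ z
      -- Here w is to be i - j, and t = i - 3 j, so j must be (w - t) / 2.
      from (s , t) (eq , divides w level≡) = halve ((w - t) %ℕ 2) ((w - t) /ℕ 2) (n%ℕd<d (w - t) 2) (a≡a%ℕn+[a/ℕn]*n (w - t) 2)
        where
        s≡ : s ≡ w * + 5 - + 1 - + 2 * t
        s≡ = trans (cancel s t) (cong (λ x → x - + 1 - + 2 * t) level≡)
          where
          cancel : ∀ s t → s ≡ s + + 2 * t + + 1 - + 1 - + 2 * t
          cancel = ℤ-Ring.solve-∀
        halve : ∀ r v → r < 2 → w - t ≡ + r + v * + 2 → _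
        halve 0 v _ w-t≡ = (w + v , v) , ∈-box i≤ j≤ , exps , φ≡
          where
          t≡ : t ≡ w - + 2 * v
          t≡ = trans (cancel w t) (trans (cong (λ x → w - x) w-t≡) (swap w v))
            where
            cancel : ∀ w t → t ≡ w - (w - t)
            cancel = ℤ-Ring.solve-∀
            swap : ∀ w v → w - (+ 0 + v * + 2) ≡ w - + 2 * v
            swap = ℤ-Ring.solve-∀
          φ≡ : φ (w + v , v) ≡ (s , t)
          φ≡ = cong₂ _,_ (sym (trans s≡ (trans (cong (λ x → w * + 5 - + 1 - + 2 * x) t≡) (fst w v)))) (sym (trans t≡ (snd w v)))
            where
            fst : ∀ w v → w * + 5 - + 1 - + 2 * (w - + 2 * v) ≡ + 3 * (w + v) + v - + 1
            fst = ℤ-Ring.solve-∀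
            snd : ∀ w v → w - + 2 * v ≡ w + v - + 3 * v
            snd = ℤ-Ring.solve-∀
          exps : Θ₁.exponent (w + v) ℕ.+ Θ₂.exponent v ≡ n
          exps = N-injective (trans (Θ-norm (w + v) v) (trans (cong (λ z → proj₁ z * proj₁ z + proj₂ z * proj₂ z) φ≡) eq))
          i≤ : ∣ w + v ∣ ≤ K
          i≤ = ℕₚ.≤-trans (Θ₁.exponent-≥ (s≤s z≤n) (s≤s z≤n) (w + v)) (ℕₚ.≤-trans (ℕₚ.m≤m+n _ _) (ℕₚ.≤-trans (ℕₚ.≤-reflexive exps) n≤K))
          j≤ : ∣ v ∣ ≤ K
          j≤ = ℕₚ.≤-trans (Θ₂.exponent-≥ (s≤s z≤n) (s≤s z≤n) v) (ℕₚ.≤-trans (ℕₚ.m≤n+m _ _) (ℕₚ.≤-trans (ℕₚ.≤-reflexive exps) n≤K))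
        -- If w - t is odd, then s = 5 w - 1 - 2 t has the parity of t and the norm is even, whereas
        -- N = 4 n + 1 is odd.
        halve 1 v _ w-t≡ = contradiction (even-norm) λ ()
          where
          t≡ : t ≡ w - + 1 - + 2 * v
          t≡ = trans (cancel w t) (trans (cong (λ x → w - x) w-t≡) (swap w v))
            where
            cancel : ∀ w t → t ≡ w - (w - t)
            cancel = ℤ-Ring.solve-∀
            swap : ∀ w v → w - (+ 1 + v * + 2) ≡ w - + 1 - + 2 * v
            swap = ℤ-Ring.solve-∀
          Q : ℤ
          Q = (+ 2 * w + v) * (+ 2 * w + v) + (w + + 3 * v + + 1) * (w + + 3 * v + + 1)
          norm≡ : N ≡ + 0 + Q * + 2
          norm≡ = trans (sym eq) (trans (cong (λ x → x * x + t * t) s≡) (trans (cong (λ x → (w * + 5 - + 1 - + 2 * x) * (w * + 5 - + 1 - + 2 * x) + x * x) t≡) (expand w v)))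
            where
            expand : ∀ w v → (w * + 5 - + 1 - + 2 * (w - + 1 - + 2 * v)) * (w * + 5 - + 1 - + 2 * (w - + 1 - + 2 * v)) + (w - + 1 - + 2 * v) * (w - + 1 - + 2 * v)
              ≡ + 0 + ((+ 2 * w + v) * (+ 2 * w + v) + (w + + 3 * v + + 1) * (w + + 3 * v + + 1)) * + 2
            expand = ℤ-Ring.solve-∀
          even-norm : false ≡ true
          even-norm = trans (∣-shift (+ 2) (+ 1) N (+ 2 * + n) (swap (+ n))) (sym (trans (∣-shift (+ 2) (+ 0) (+ 0 + Q * + 2) Q refl) (cong (λ x → does (+ 2 ∣? x)) (sym norm≡))))
            where
            swap : ∀ n → + 4 * n + + 1 ≡ + 1 + + 2 * n * + 2
            swap = ℤ-Ring.solve-∀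
        halve (suc (suc _)) v (s≤s (s≤s ())) _

    Ψ₁? : Decidable (λ j → Ψ₁.exponent j ≡ n)
    Ψ₁? j = Ψ₁.exponent j ℕ.≟ n

    Ψ₅? : Decidable (λ j → 1 ℕ.+ Ψ₅.exponent j ≡ n)
    Ψ₅? j = 1 ℕ.+ Ψ₅.exponent j ℕ.≟ n

    1-4j-injective : ∀ {j j′} → + 1 - + 4 * j ≡ + 1 - + 4 * j′ → j ≡ j′
    1-4j-injective {j} {j′} eq = ℤₚ.*-cancelˡ-≡ (+ 4) j j′
      (trans (recover j) (trans (cong (λ x → + 1 - x) eq) (sym (recover j′))))
      where
      recover : ∀ j → + 4 * j ≡ + 1 - (+ 1 - + 4 * j)
      recover = ℤ-Ring.solve-∀

    1-4j-class : ∀ j → + 1 - + 4 * j - + 1 ≡ - j * + 4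
    1-4j-class = ℤ-Ring.solve-∀

    1-4j-surjective : ∀ s q → s - + 1 ≡ q * + 4 → + 1 - + 4 * - q ≡ s
    1-4j-surjective s q eq = trans (negate q) (trans (cong (λ x → + 1 + x) (sym eq)) (cancel s))
      where
      negate : ∀ q → + 1 - + 4 * - q ≡ + 1 + q * + 4
      negate = ℤ-Ring.solve-∀
      cancel : ∀ s → + 1 + (s - + 1) ≡ s
      cancel = ℤ-Ring.solve-∀

    Ψ₁≡ : parity Ψ₁? (interval K) ≡ parity (λ s → (s * s ≟ N) ×-dec (+ 4 ∣? (s - + 1))) (interval bound)
    Ψ₁≡ = parity-reindex Ψ₁? (λ s → (s * s ≟ N) ×-dec (+ 4 ∣? (s - + 1))) (interval! K) (interval! bound)
      (λ j → + 1 - + 4 * j) 1-4j-injective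
      (λ { {j} refl → sym (Ψ₁-norm j) , divides (- j) (1-4j-class j) })
      (λ { {s} (eq , _) → ∈-interval (proj₁ (two-squares-bound s (+ 0) (trans (ℤₚ.+-identityʳ (s * s)) (trans eq N≡bound)))) })
      (λ { {s} (eq , divides q s≡) →
        let φ≡ = 1-4j-surjective s q s≡
            exp≡ = N-injective (trans (Ψ₁-norm (- q)) (trans (cong (λ x → x * x) φ≡) eq))
        in - q , ∈-interval (ℕₚ.≤-trans (Ψ₁.exponent-≥ (s≤s z≤n) (s≤s z≤n) (- q)) (ℕₚ.≤-trans (ℕₚ.≤-reflexive exp≡) n≤K)) , exp≡ , φ≡ })

    Ψ₅≡ : parity Ψ₅? (interval K) ≡ parity (λ x → (+ 5 * (x * x) ≟ N) ×-dec (+ 4 ∣? (x - + 1))) (interval bound)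
    Ψ₅≡ = parity-reindex Ψ₅? (λ x → (+ 5 * (x * x) ≟ N) ×-dec (+ 4 ∣? (x - + 1))) (interval! K) (interval! bound)
      (λ j → + 1 - + 4 * j) 1-4j-injective
      (λ { {j} refl → sym (Ψ₅-norm j) , divides (- j) (1-4j-class j) })
      (λ { {x} (eq , _) → ∈-interval (proj₁ (five-bound x (+ 0) (trans (cong (+ 5 *_) (ℤₚ.+-identityʳ (x * x))) eq))) })
      (λ { {x} (eq , divides q x≡) →
        let φ≡ = 1-4j-surjective x q x≡
            exp≡ = N-injective (trans (Ψ₅-norm (- q)) (trans (cong (λ x → + 5 * (x * x)) φ≡) eq))
        in - q , ∈-interval (ℕₚ.≤-trans (Ψ₅.exponent-≥ (s≤s z≤n) (s≤s z≤n) (- q)) (ℕₚ.≤-trans (ℕₚ.n≤1+n _) (ℕₚ.≤-trans (ℕₚ.≤-reflexive exp≡) n≤K))) , exp≡ , φ≡ })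

    ΘΘ≡Ψ₁+Ψ₅ : parity ΘΘ? (box K) ≡ parity Ψ₁? (interval K) xor parity Ψ₅? (interval K)
    ΘΘ≡Ψ₁+Ψ₅ = trans ΘΘ≡ (trans primary≡ (cong₂ _xor_ (trans one-mod-4≡ (sym Ψ₁≡)) (trans V≡ (sym Ψ₅≡))))

-- Euler products modulo 2

≈-weaken : ∀ {f g M N} → M ≤ N → f ≈[ N ] g → f ≈[ M ] g
≈-weaken M≤N f≈g = mk≈ λ n<M → coeff f≈g (ℕₚ.<-≤-trans n<M M≤N)

at : ∀ {f g} n → (∀ {N} → f ≈[ N ] g) → f n ≡ g n
at n f≈g = coeff f≈g (ℕₚ.n<1+n n)

⨁-++ : {A : Set} (f : A → Bool) → ∀ xs ys → ⨁ f (xs ++ ys) ≡ ⨁ f xs xor ⨁ f ys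
⨁-++ f []       ys = refl
⨁-++ f (x ∷ xs) ys = trans (cong (f x xor_) (⨁-++ f xs ys)) (sym (xor-assoc (f x) (⨁ f xs) (⨁ f ys)))

⨁-map : {A B : Set} (f : B → Bool) (g : A → B) → ∀ xs → ⨁ f (map g xs) ≡ ⨁ (f ∘ g) xs
⨁-map f g []       = refl
⨁-map f g (x ∷ xs) = cong (f (g x) xor_) (⨁-map f g xs)

coeff-Σ< : ∀ {A : Set} (e : A → ℕ) (g : ℕ → A) M n →
  Σ< M (λ k → q^ e (g k)) n ≡ parity (λ x → e x ℕ.≟ n) (applyUpTo g M)
coeff-Σ< e g zero    n = trans (at n Σ<-zero) (coeff-𝟘 n)
coeff-Σ< e g (suc M) n = begin
  Σ< (suc M) (λ k → q^ e (g k)) n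
    ≡⟨ at n (Σ<-suc M (λ k → q^ e (g k))) ⟩
  (q^ e (g 0) ⊕ Σ< M (λ k → q^ e (g (suc k)))) n
    ≡⟨ coeff-⊕ (q^ e (g 0)) _ n ⟩
  (q^ e (g 0)) n xor Σ< M (λ k → q^ e (g (suc k))) n
    ≡⟨ cong₂ _xor_ (coeff-q^ (e (g 0)) n) (coeff-Σ< e (g ∘ suc) M n) ⟩
  parity (λ x → e x ℕ.≟ n) (applyUpTo g (suc M)) ∎
  where open ≡-Reasoning

coeff-q^·Σ< : ∀ {A : Set} a (e : A → ℕ) (g : ℕ → A) M n →
  (q^ a · Σ< M (λ k → q^ e (g k))) n ≡ parity (λ x → a ℕ.+ e x ℕ.≟ n) (applyUpTo g M)
coeff-q^·Σ< a e g M n = trans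
  (at n (≈-trans (≈-sym (Σ<-· M (q^ a) (λ k → q^ e (g k)))) (Σ<-cong M (λ {k} _ → q^-+ a (e (g k))))))
  (coeff-Σ< (λ x → a ℕ.+ e x) g M n)

coeff-Σ<·Σ< : ∀ {A B : Set} (e : A → ℕ) (g : ℕ → A) (e′ : B → ℕ) (g′ : ℕ → B) M M′ n →
  (Σ< M (λ k → q^ e (g k)) · Σ< M′ (λ k → q^ e′ (g′ k))) n ≡
  parity (λ z → e (proj₁ z) ℕ.+ e′ (proj₂ z) ℕ.≟ n) (cartesianProduct (applyUpTo g M) (applyUpTo g′ M′))
coeff-Σ<·Σ< e g e′ g′ zero    M′ n = trans (at n (≈-trans (·-congʳ Σ<-zero) (zeroˡ _))) (coeff-𝟘 n)
coeff-Σ<·Σ< {A} {B} e g e′ g′ (suc M) M′ n = begin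
  (Σ< (suc M) (λ k → q^ e (g k)) · S) n
    ≡⟨ at n (≈-trans (·-congʳ (Σ<-suc M (λ k → q^ e (g k)))) (·-⊕-distribʳ S (q^ e (g 0)) R)) ⟩
  (q^ e (g 0) · S ⊕ R · S) n
    ≡⟨ coeff-⊕ (q^ e (g 0) · S) (R · S) n ⟩
  (q^ e (g 0) · S) n xor (R · S) n
    ≡⟨ cong₂ _xor_ (trans (coeff-q^·Σ< (e (g 0)) e′ g′ M′ n) (sym (⨁-map f (g 0 ,_) (applyUpTo g′ M′))))
                   (coeff-Σ<·Σ< e (g ∘ suc) e′ g′ M M′ n) ⟩
  ⨁ f (map (g 0 ,_) (applyUpTo g′ M′)) xor ⨁ f (cartesianProduct (applyUpTo (g ∘ suc) M) (applyUpTo g′ M′))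
    ≡⟨ ⨁-++ f (map (g 0 ,_) (applyUpTo g′ M′)) _ ⟨
  ⨁ f (cartesianProduct (applyUpTo g (suc M)) (applyUpTo g′ M′)) ∎
  where
  open ≡-Reasoning
  S = Σ< M′ (λ k → q^ e′ (g′ k))
  R = Σ< M (λ k → q^ e (g (suc k)))
  f : A × B → Bool
  f z = does (e (proj₁ z) ℕ.+ e′ (proj₂ z) ℕ.≟ n)

-- The products E_t, their squares, cubes and splittings by residue

E : ℕ → ℕ → 𝔽₂⟦q⟧
E t M = poch t t M

-- Squaring is additive in characteristic 2, so every factor squares to the one with doubled
-- exponent; the identity is exact for each number of factors.
frobenius : ∀ t M {N} → E t M · E t M ≈[ N ] E (2 ℕ.* t) M
frobenius t zero    = 𝟙· 𝟙
frobenius t (suc M) = begin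
  (𝟙 ⊕ x) · E t M · ((𝟙 ⊕ x) · E t M)
    ≈⟨ solve 2 (λ x y → (con true :+ x) :* y :* ((con true :+ x) :* y) := (con true :+ x :* x) :* (y :* y)) ≈-refl x (E t M) ⟩
  (𝟙 ⊕ x · x) · (E t M · E t M)
    ≈⟨ ·-cong (⊕-congˡ (≈-trans (q^-+ _ _) (≈-reflexive (cong q^_ (double t M))))) (frobenius t M) ⟩
  E (2 ℕ.* t) (suc M) ∎
  where
  open ≈-Reasoning
  open 𝔽₂-Solver
  x = q^ (t ℕ.+ t ℕ.* M)
  double : ∀ t M → t ℕ.+ t ℕ.* M ℕ.+ (t ℕ.+ t ℕ.* M) ≡ 2 ℕ.* t ℕ.+ 2 ℕ.* t ℕ.* M
  double = ℕ-Ring.solve-∀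

factor-cong : ∀ {a b N} → a ≡ b → 𝟙 ⊕ q^ a ≈[ N ] 𝟙 ⊕ q^ b
factor-cong refl = ≈-refl

-- Sorts the factors by the residue of their index; a number of factors divisible by the modulus
-- makes this exact, likewise for 4 and 5 below.
E-mod-2 : ∀ t M {N} → E t (M ℕ.* 2) ≈[ N ] poch t (2 ℕ.* t) M · poch (2 ℕ.* t) (2 ℕ.* t) M
E-mod-2 t zero    = ≈-sym (𝟙· 𝟙)
E-mod-2 t (suc M) = ≈-trans
  (·-cong (factor-cong (e₂ t M)) (·-cong (factor-cong (e₁ t M)) (E-mod-2 t M)))
  (solve 4 (λ a b x y → b :* (a :* (x :* y)) := a :* x :* (b :* y)) ≈-refl _ _ _ _)
  where
  open 𝔽₂-Solver
  e₁ : ∀ t M → t ℕ.+ t ℕ.* (M ℕ.* 2) ≡ t ℕ.+ 2 ℕ.* t ℕ.* M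
  e₁ = ℕ-Ring.solve-∀
  e₂ : ∀ t M → t ℕ.+ t ℕ.* suc (M ℕ.* 2) ≡ 2 ℕ.* t ℕ.+ 2 ℕ.* t ℕ.* M
  e₂ = ℕ-Ring.solve-∀

E-mod-4 : ∀ t M {N} → E t (M ℕ.* 4) ≈[ N ]
  poch t (4 ℕ.* t) M · poch (2 ℕ.* t) (4 ℕ.* t) M · poch (3 ℕ.* t) (4 ℕ.* t) M · poch (4 ℕ.* t) (4 ℕ.* t) M
E-mod-4 t zero    = ≈-sym (solve 0 (con true :* con true :* con true :* con true := con true) ≈-refl)
  where open 𝔽₂-Solver
E-mod-4 t (suc M) = ≈-trans
  (·-cong (factor-cong (e₄ t M)) (·-cong (factor-cong (e₃ t M)) (·-cong (factor-cong (e₂ t M))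
    (·-cong (factor-cong (e₁ t M)) (E-mod-4 t M)))))
  (solve 8 (λ a b c d x y z w → d :* (c :* (b :* (a :* (x :* y :* z :* w)))) :=
     a :* x :* (b :* y) :* (c :* z) :* (d :* w)) ≈-refl _ _ _ _ _ _ _ _)
  where
  open 𝔽₂-Solver
  e₁ : ∀ t M → t ℕ.+ t ℕ.* (M ℕ.* 4) ≡ t ℕ.+ 4 ℕ.* t ℕ.* M
  e₁ = ℕ-Ring.solve-∀
  e₂ : ∀ t M → t ℕ.+ t ℕ.* suc (M ℕ.* 4) ≡ 2 ℕ.* t ℕ.+ 4 ℕ.* t ℕ.* M
  e₂ = ℕ-Ring.solve-∀
  e₃ : ∀ t M → t ℕ.+ t ℕ.* suc (suc (M ℕ.* 4)) ≡ 3 ℕ.* t ℕ.+ 4 ℕ.* t ℕ.* M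
  e₃ = ℕ-Ring.solve-∀
  e₄ : ∀ t M → t ℕ.+ t ℕ.* suc (suc (suc (M ℕ.* 4))) ≡ 4 ℕ.* t ℕ.+ 4 ℕ.* t ℕ.* M
  e₄ = ℕ-Ring.solve-∀

E₁-mod-5 : ∀ M {N} → E 1 (M ℕ.* 5) ≈[ N ]
  poch 1 5 M · poch 4 5 M · (poch 2 5 M · poch 3 5 M) · poch 5 5 M
E₁-mod-5 zero    = ≈-sym (solve 0 (con true :* con true :* (con true :* con true) :* con true := con true) ≈-refl)
  where open 𝔽₂-Solver
E₁-mod-5 (suc M) = ≈-trans
  (·-cong (factor-cong (e₅ M)) (·-cong (factor-cong (e₄ M)) (·-cong (factor-cong (e₃ M)) (·-cong (factor-cong (e₂ M))
    (·-cong (factor-cong (e₁ M)) (E₁-mod-5 M))))))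
  (solve 10 (λ a b c d e x y z w v → e :* (d :* (c :* (b :* (a :* (x :* w :* (y :* z) :* v))))) :=
     a :* x :* (d :* w) :* (b :* y :* (c :* z)) :* (e :* v)) ≈-refl _ _ _ _ _ _ _ _ _ _)
  where
  open 𝔽₂-Solver
  e₁ : ∀ M → 1 ℕ.+ 1 ℕ.* (M ℕ.* 5) ≡ 1 ℕ.+ 5 ℕ.* M
  e₁ = ℕ-Ring.solve-∀
  e₂ : ∀ M → 1 ℕ.+ 1 ℕ.* suc (M ℕ.* 5) ≡ 2 ℕ.+ 5 ℕ.* M
  e₂ = ℕ-Ring.solve-∀
  e₃ : ∀ M → 1 ℕ.+ 1 ℕ.* suc (suc (M ℕ.* 5)) ≡ 3 ℕ.+ 5 ℕ.* M
  e₃ = ℕ-Ring.solve-∀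
  e₄ : ∀ M → 1 ℕ.+ 1 ℕ.* suc (suc (suc (M ℕ.* 5))) ≡ 4 ℕ.+ 5 ℕ.* M
  e₄ = ℕ-Ring.solve-∀
  e₅ : ∀ M → 1 ℕ.+ 1 ℕ.* suc (suc (suc (suc (M ℕ.* 5)))) ≡ 5 ℕ.+ 5 ℕ.* M
  e₅ = ℕ-Ring.solve-∀

E-stable : ∀ {t L M M′} → 1 ≤ t → L ≤ M → L ≤ M′ → E t M ≈[ L ] E t M′
E-stable 1≤t L≤M L≤M′ = ≈-trans (poch-stable 1≤t L≤M) (≈-sym (poch-stable 1≤t L≤M′))

cube : 𝔽₂⟦q⟧ → 𝔽₂⟦q⟧
cube f = f · f · f

cube-cong : ∀ {f g N} → f ≈[ N ] g → cube f ≈[ N ] cube g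
cube-cong eq = ·-cong (·-cong eq eq) eq

-- The exponents on the right are t times the triangular numbers, each occurring once.
jacobi : ∀ t L → 1 ≤ t → let K = L ℕ.+ L in
  cube (E t K) ≈[ L ] Σ< (suc (K ℕ.+ K)) (λ k → q^ Theta.exponent (4 ℕ.* t) t (3 ℕ.* t) refl (k ⊖ K))
-- Frobenius gives E_t⁵ = E_t E_{4t}, which splits modulo 4 into p₁ p₂ p₃ p₄ p₄. Cancelling E_t² =
-- E_{2t} = p₂ p₄ leaves p₄ p₁ p₃, a triple product with period 4 t.
jacobi t L 1≤t = ≈-trans (unit-cancel (E t K · E t K) unit (begin
  E t K · E t K · cube (E t K)
    ≈⟨ solve 1 (λ x → x :* x :* (x :* x :* x) := x :* (x :* x :* (x :* x))) ≈-refl (E t K) ⟩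
  E t K · (E t K · E t K · (E t K · E t K))
    ≈⟨ ·-cong (E-stable 1≤t L≤K (ℕₚ.≤-trans L≤K (ℕₚ.m≤m*n K 4))) fourth ⟩
  E t (K ℕ.* 4) · E (4 ℕ.* t) K
    ≈⟨ ·-congʳ (E-mod-4 t K) ⟩
  p₁ · p₂ · p₃ · p₄ · p₄
    ≈⟨ solve 4 (λ a b c d → a :* b :* c :* d :* d := b :* d :* (d :* (a :* c))) ≈-refl p₁ p₂ p₃ p₄ ⟩
  p₂ · p₄ · (p₄ · (p₁ · p₃))
    ≈⟨ ·-congʳ even-part ⟨
  E t K · E t K · (p₄ · (p₁ · p₃)) ∎))
  (Theta.triple-product (4 ℕ.* t) t (3 ℕ.* t) refl 1≤t (ℕₚ.≤-trans 1≤t (ℕₚ.m≤m+n t _)) L)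
  where
  open ≈-Reasoning
  open 𝔽₂-Solver
  K = L ℕ.+ L
  L≤K = ℕₚ.m≤m+n L L
  p₁ = poch t (4 ℕ.* t) K
  p₂ = poch (2 ℕ.* t) (4 ℕ.* t) K
  p₃ = poch (3 ℕ.* t) (4 ℕ.* t) K
  p₄ = poch (4 ℕ.* t) (4 ℕ.* t) K
  unit : (E t K · E t K) 0 ≡ true
  unit = trans (·-coeff-zero (E t K) (E t K)) (cong₂ _∧_ (poch-coeff₀ t K 1≤t) (poch-coeff₀ t K 1≤t))
  2*2* : ∀ t → 2 ℕ.* (2 ℕ.* t) ≡ 4 ℕ.* t
  2*2* = ℕ-Ring.solve-∀
  fourth : E t K · E t K · (E t K · E t K) ≈[ L ] E (4 ℕ.* t) K
  fourth = ≈-trans (·-cong (frobenius t K) (frobenius t K)) (≈-trans (frobenius (2 ℕ.* t) K) (≈-reflexive (cong (λ s → E s K) (2*2* t))))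
  even-part : E t K · E t K ≈[ L ] p₂ · p₄
  even-part = ≈-trans (frobenius t K) (≈-trans
    (E-stable (ℕₚ.≤-trans 1≤t (ℕₚ.m≤m+n t _)) L≤K (ℕₚ.≤-trans L≤K (ℕₚ.m≤m*n K 2)))
    (≈-trans (E-mod-2 (2 ℕ.* t) K) (≈-reflexive (cong (λ s → poch (2 ℕ.* t) s K · poch s s K) (2*2* t)))))

-- The nonzero residues modulo 5 pair off as 1, 4 and 2, 3. Each pair needs its own E₅ for a triple
-- product: one is contained in E₁, the other is the second factor.
E₁E₅≈ΘΘ : ∀ L → let K = L ℕ.+ L in E 1 K · E 5 K ≈[ L ]
  Σ< (suc (K ℕ.+ K)) (λ k → q^ Theta.exponent 5 1 4 refl (k ⊖ K)) · Σ< (suc (K ℕ.+ K)) (λ k → q^ Theta.exponent 5 2 3 refl (k ⊖ K))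
E₁E₅≈ΘΘ L = begin
  E 1 K · E 5 K
    ≈⟨ ·-congʳ (≈-trans (E-stable (s≤s z≤n) L≤K (ℕₚ.≤-trans L≤K (ℕₚ.m≤m*n K 5))) (E₁-mod-5 K)) ⟩
  p 1 · p 4 · (p 2 · p 3) · p 5 · p 5
    ≈⟨ solve 3 (λ a b c → a :* b :* c :* c := c :* a :* (c :* b)) ≈-refl (p 1 · p 4) (p 2 · p 3) (p 5) ⟩
  p 5 · (p 1 · p 4) · (p 5 · (p 2 · p 3))
    ≈⟨ ·-cong (Theta.triple-product 5 1 4 refl (s≤s z≤n) (s≤s z≤n) L) (Theta.triple-product 5 2 3 refl (s≤s z≤n) (s≤s z≤n) L) ⟩
  _ ∎
  where
  open ≈-Reasoning
  open 𝔽₂-Solver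
  K = L ℕ.+ L
  L≤K = ℕₚ.m≤m+n L L
  p : ℕ → 𝔽₂⟦q⟧
  p a = poch a 5 K

module _ (L : ℕ) where

  private
    K : ℕ
    K = L ℕ.+ L

  coeff-E₁E₅ : ∀ {n} → n < L → (E 1 K · E 5 K) n ≡
    parity (λ j → Theta.exponent 8 2 6 refl j ℕ.≟ n) (interval K) xor
    parity (λ j → 1 ℕ.+ Theta.exponent 40 10 30 refl j ℕ.≟ n) (interval K)
  coeff-E₁E₅ {n} n<L = trans (coeff (E₁E₅≈ΘΘ L) n<L)
    (trans (coeff-Σ<·Σ< (Theta.exponent 5 1 4 refl) (_⊖ K) (Theta.exponent 5 2 3 refl) (_⊖ K) (suc (K ℕ.+ K)) (suc (K ℕ.+ K)) n)
      (Lattice.ΘΘ≡Ψ₁+Ψ₅ n (ℕₚ.≤-trans (ℕₚ.<⇒≤ n<L) (ℕₚ.m≤m+n L L))))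

  -- The cube precedes q^1 so that `evens-cube·` and `odds-cube·` can take it out in front.
  E₁E₅≈ : E 1 K · E 5 K ≈[ L ] cube (E 2 K) ⊕ cube (E 10 K) · q^ 1
  E₁E₅≈ = mk≈ λ {n} n<L → trans (coeff-E₁E₅ n<L) (sym (begin
    (cube (E 2 K) ⊕ cube (E 10 K) · q^ 1) n
      ≡⟨ coeff (⊕-cong (jacobi 2 L (s≤s z≤n)) (≈-trans (solve 2 (λ x y → x :* y := y :* x) ≈-refl _ _) (·-congˡ (jacobi 10 L (s≤s z≤n))))) n<L ⟩
    (Σ< (suc (K ℕ.+ K)) (λ k → q^ Theta.exponent 8 2 6 refl (k ⊖ K)) ⊕ q^ 1 · Σ< (suc (K ℕ.+ K)) (λ k → q^ Theta.exponent 40 10 30 refl (k ⊖ K))) n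
      ≡⟨ coeff-⊕ _ _ n ⟩
    _ ≡⟨ cong₂ _xor_ (coeff-Σ< (Theta.exponent 8 2 6 refl) (_⊖ K) (suc (K ℕ.+ K)) n)
           (coeff-q^·Σ< 1 (Theta.exponent 40 10 30 refl) (_⊖ K) (suc (K ℕ.+ K)) n) ⟩
    _ ∎))
    where
    open ≡-Reasoning
    open 𝔽₂-Solver

-- Even and odd parts of a series

coeff-q^suc·-zero : ∀ a f → (q^ suc a · f) 0 ≡ false
coeff-q^suc·-zero a f = trans (·-coeff-zero (q^ suc a) f) (cong (_∧ f 0) (coeff-q^ (suc a) 0))

opaque
  unfolding _⊕_

  coeff-q^suc·-suc : ∀ a f n → (q^ suc a · f) (suc n) ≡ (q^ a · f) n
  coeff-q^suc·-suc a f n = refl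

coeff-q^· : ∀ a f n → (q^ a · f) (a ℕ.+ n) ≡ f n
coeff-q^· zero    f n = ·-identityˡ f n
coeff-q^· (suc a) f n = trans (coeff-q^suc·-suc a f (a ℕ.+ n)) (coeff-q^· a f n)

coeff-q^·-< : ∀ {a n} f → n < a → (q^ a · f) n ≡ false
coeff-q^·-< {suc a} {zero}  f _         = coeff-q^suc·-zero a f
coeff-q^·-< {suc a} {suc n} f (s≤s n<a) = trans (coeff-q^suc·-suc a f n) (coeff-q^·-< f n<a)

coeff-[1+q^]· : ∀ a f n → ((𝟙 ⊕ q^ a) · f) n ≡ f n xor (q^ a · f) n
coeff-[1+q^]· a f n = trans (at n (≈-trans (·-⊕-distribʳ f 𝟙 (q^ a)) (⊕-congʳ (𝟙· f)))) (coeff-⊕ f (q^ a · f) n)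

evens odds : 𝔽₂⟦q⟧ → 𝔽₂⟦q⟧
evens f n = f (n ℕ.+ n)
odds  f n = f (suc (n ℕ.+ n))

-- The first K even coefficients end at index 2 K - 2, so precision 2 K - 1 is enough; the odd ones
-- need 2 K. The first step of `dissection` uses this gain of one.
evens-cong : ∀ {f g K N} → f ≈[ N ] g → K ℕ.+ K ≤ suc N → evens f ≈[ K ] evens g
evens-cong f≈g 2K≤N = mk≈ λ {n} n<K → coeff f≈g
  (ℕₚ.≤-pred (ℕₚ.≤-trans (s≤s (ℕₚ.≤-reflexive (sym (ℕₚ.+-suc n n)))) (ℕₚ.≤-trans (ℕₚ.+-mono-≤ n<K n<K) 2K≤N)))

odds-cong : ∀ {f g K N} → f ≈[ N ] g → K ℕ.+ K ≤ N → odds f ≈[ K ] odds g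
odds-cong f≈g 2K≤N = mk≈ λ {n} n<K → coeff f≈g
  (ℕₚ.≤-trans (s≤s (ℕₚ.≤-reflexive (sym (ℕₚ.+-suc n n)))) (ℕₚ.≤-trans (ℕₚ.+-mono-≤ n<K n<K) 2K≤N))

evens-⊕ : ∀ f g {N} → evens (f ⊕ g) ≈[ N ] evens f ⊕ evens g
evens-⊕ f g = pointwise λ n → trans (coeff-⊕ f g (n ℕ.+ n)) (sym (coeff-⊕ (evens f) (evens g) n))

odds-⊕ : ∀ f g {N} → odds (f ⊕ g) ≈[ N ] odds f ⊕ odds g
odds-⊕ f g = pointwise λ n → trans (coeff-⊕ f g (suc (n ℕ.+ n))) (sym (coeff-⊕ (odds f) (odds g) n))

evens-q^· : ∀ e f {N} → evens (q^ (e ℕ.+ e) · f) ≈[ N ] q^ e · evens f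
evens-q^· e f = pointwise (go e)
  where
  go : ∀ e n → (q^ (e ℕ.+ e) · f) (n ℕ.+ n) ≡ (q^ e · evens f) n
  go zero    n    = trans (·-identityˡ f (n ℕ.+ n)) (sym (·-identityˡ (evens f) n))
  go (suc e) zero = trans (coeff-q^suc·-zero (e ℕ.+ suc e) f) (sym (coeff-q^suc·-zero e (evens f)))
  go (suc e) (suc n) = begin
    (q^ suc (e ℕ.+ suc e) · f) (suc (n ℕ.+ suc n)) ≡⟨ coeff-q^suc·-suc (e ℕ.+ suc e) f (n ℕ.+ suc n) ⟩
    (q^ (e ℕ.+ suc e) · f) (n ℕ.+ suc n)           ≡⟨ cong₂ (λ a i → (q^ a · f) i) (ℕₚ.+-suc e e) (ℕₚ.+-suc n n) ⟩
    (q^ suc (e ℕ.+ e) · f) (suc (n ℕ.+ n))         ≡⟨ coeff-q^suc·-suc (e ℕ.+ e) f (n ℕ.+ n) ⟩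
    (q^ (e ℕ.+ e) · f) (n ℕ.+ n)                   ≡⟨ go e n ⟩
    (q^ e · evens f) n                             ≡⟨ coeff-q^suc·-suc e (evens f) n ⟨
    (q^ suc e · evens f) (suc n)                   ∎
    where open ≡-Reasoning

odds-q^· : ∀ e f {N} → odds (q^ (e ℕ.+ e) · f) ≈[ N ] q^ e · odds f
odds-q^· e f = pointwise (go e)
  where
  go : ∀ e n → (q^ (e ℕ.+ e) · f) (suc (n ℕ.+ n)) ≡ (q^ e · odds f) n
  go zero    n    = trans (·-identityˡ f (suc (n ℕ.+ n))) (sym (·-identityˡ (odds f) n))
  go (suc e) zero = trans (coeff-q^·-< f (s≤s (ℕₚ.≤-trans (s≤s z≤n) (ℕₚ.m≤n+m (suc e) e)))) (sym (coeff-q^suc·-zero e (odds f)))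
  go (suc e) (suc n) = begin
    (q^ suc (e ℕ.+ suc e) · f) (suc (suc (n ℕ.+ suc n))) ≡⟨ coeff-q^suc·-suc (e ℕ.+ suc e) f (suc (n ℕ.+ suc n)) ⟩
    (q^ (e ℕ.+ suc e) · f) (suc (n ℕ.+ suc n))           ≡⟨ cong₂ (λ a i → (q^ a · f) (suc i)) (ℕₚ.+-suc e e) (ℕₚ.+-suc n n) ⟩
    (q^ suc (e ℕ.+ e) · f) (suc (suc (n ℕ.+ n)))         ≡⟨ coeff-q^suc·-suc (e ℕ.+ e) f (suc (n ℕ.+ n)) ⟩
    (q^ (e ℕ.+ e) · f) (suc (n ℕ.+ n))                   ≡⟨ go e n ⟩
    (q^ e · odds f) n                                    ≡⟨ coeff-q^suc·-suc e (odds f) n ⟨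
    (q^ suc e · odds f) (suc n)                          ∎
    where open ≡-Reasoning

module _ (part : 𝔽₂⟦q⟧ → 𝔽₂⟦q⟧)
         (part-cong : ∀ {f g} → (∀ {N} → f ≈[ N ] g) → ∀ {N} → part f ≈[ N ] part g)
         (part-⊕ : ∀ f g {N} → part (f ⊕ g) ≈[ N ] part f ⊕ part g)
         (part-q^· : ∀ e f {N} → part (q^ (e ℕ.+ e) · f) ≈[ N ] q^ e · part f) where

  -- Taking a part is linear over series in q², and E_{2t}(q) = E_t(q²); the factors are taken out
  -- one by one.
  part-E· : ∀ t M f {N} → part (E (2 ℕ.* t) M · f) ≈[ N ] E t M · part f
  part-E· t zero    f = ≈-trans (part-cong (𝟙· f)) (≈-sym (𝟙· part f))
  part-E· t (suc M) f = begin
    part ((𝟙 ⊕ q^ (2 ℕ.* t ℕ.+ 2 ℕ.* t ℕ.* M)) · E (2 ℕ.* t) M · f)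
      ≈⟨ part-cong (≈-trans (·-congʳ (·-congʳ (factor-cong (double t M))))
           (solve 3 (λ x y z → (con true :+ x) :* y :* z := y :* z :+ x :* (y :* z)) ≈-refl (q^ (e ℕ.+ e)) (E (2 ℕ.* t) M) f)) ⟩
    part (E (2 ℕ.* t) M · f ⊕ q^ (e ℕ.+ e) · (E (2 ℕ.* t) M · f))
      ≈⟨ part-⊕ _ _ ⟩
    part (E (2 ℕ.* t) M · f) ⊕ part (q^ (e ℕ.+ e) · (E (2 ℕ.* t) M · f))
      ≈⟨ ⊕-congˡ (part-q^· e _) ⟩
    part (E (2 ℕ.* t) M · f) ⊕ q^ e · part (E (2 ℕ.* t) M · f)
      ≈⟨ ⊕-cong (part-E· t M f) (·-congˡ (part-E· t M f)) ⟩
    E t M · part f ⊕ q^ e · (E t M · part f)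
      ≈⟨ solve 3 (λ x y z → y :* z :+ x :* (y :* z) := (con true :+ x) :* y :* z) ≈-refl (q^ e) (E t M) (part f) ⟩
    E t (suc M) · part f ∎
    where
    open ≈-Reasoning
    open 𝔽₂-Solver
    e = t ℕ.+ t ℕ.* M
    double : ∀ t M → 2 ℕ.* t ℕ.+ 2 ℕ.* t ℕ.* M ≡ t ℕ.+ t ℕ.* M ℕ.+ (t ℕ.+ t ℕ.* M)
    double = ℕ-Ring.solve-∀

  part-cube· : ∀ t M f {N} → part (cube (E (2 ℕ.* t) M) · f) ≈[ N ] cube (E t M) · part f
  part-cube· t M f = begin
    part (x · x · x · f)         ≈⟨ part-cong (solve 2 (λ x f → x :* x :* x :* f := x :* (x :* (x :* f))) ≈-refl x f) ⟩
    part (x · (x · (x · f)))     ≈⟨ part-E· t M _ ⟩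
    y · part (x · (x · f))       ≈⟨ ·-congˡ (≈-trans (part-E· t M _) (·-congˡ (part-E· t M f))) ⟩
    y · (y · (y · part f))       ≈⟨ solve 2 (λ x f → x :* (x :* (x :* f)) := x :* x :* x :* f) ≈-refl y (part f) ⟩
    y · y · y · part f           ∎
    where
    open ≈-Reasoning
    open 𝔽₂-Solver
    x = E (2 ℕ.* t) M
    y = E t M

evens-cube· : ∀ t M f {N} → evens (cube (E (2 ℕ.* t) M) · f) ≈[ N ] cube (E t M) · evens f
evens-cube· = part-cube· evens (λ f≈g → pointwise λ n → at (n ℕ.+ n) f≈g) evens-⊕ evens-q^·

odds-cube· : ∀ t M f {N} → odds (cube (E (2 ℕ.* t) M) · f) ≈[ N ] cube (E t M) · odds f
odds-cube· = part-cube· odds (λ f≈g → pointwise λ n → at (suc (n ℕ.+ n)) f≈g) odds-⊕ odds-q^·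

odds-E· : ∀ t M f {N} → odds (E (2 ℕ.* t) M · f) ≈[ N ] E t M · odds f
odds-E· = part-E· odds (λ f≈g → pointwise λ n → at (suc (n ℕ.+ n)) f≈g) odds-⊕ odds-q^·

evens-𝟙 : ∀ {N} → evens 𝟙 ≈[ N ] 𝟙
evens-𝟙 = pointwise λ
  { zero    → refl
  ; (suc n) → trans (coeff-q^ 0 (suc (n ℕ.+ suc n))) (sym (coeff-q^ 0 (suc n))) }

odds-𝟙 : ∀ {N} → odds 𝟙 ≈[ N ] 𝟘
odds-𝟙 = pointwise λ n → trans (coeff-q^ 0 (suc (n ℕ.+ n))) (sym (coeff-𝟘 n))

evens-q : ∀ {N} → evens (q^ 1) ≈[ N ] 𝟘
evens-q = pointwise λ
  { zero    → trans (coeff-q^ 1 0) (sym (coeff-𝟘 0))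
  ; (suc n) → trans (coeff-q^ 1 (suc (n ℕ.+ suc n))) (trans (cong (0 ≡ᵇ_) (ℕₚ.+-suc n n)) (sym (coeff-𝟘 (suc n)))) }

odds-q : ∀ {N} → odds (q^ 1) ≈[ N ] 𝟙
odds-q = pointwise λ
  { zero    → trans (coeff-q^ 1 1) (sym (coeff-q^ 0 0))
  ; (suc n) → trans (coeff-q^ 1 (suc (suc (n ℕ.+ suc n)))) (sym (coeff-q^ 0 (suc n))) }

fifth : 𝔽₂⟦q⟧ → 𝔽₂⟦q⟧
fifth f = f · (f · (f · (f · f)))

fifth-cong : ∀ {f g N} → f ≈[ N ] g → fifth f ≈[ N ] fifth g
fifth-cong eq = ·-cong eq (·-cong eq (·-cong eq (·-cong eq eq)))

-- If G = E₁ / E₅⁵, then G = (E₁ / E₅)⁶ + q, so the even part of G is (E₁ / E₅)³; as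
-- (E₁ / E₅)³ = E₂ · E₁ E₅ / E₂₀ and E₁ E₅ has odd part E₅³, its odd part is E₁ E₅³ / E₁₀ = E₁ E₅.
dissection : ∀ m {G} → let L = suc (suc (m ℕ.+ m) ℕ.+ suc (m ℕ.+ m)); K = L ℕ.+ L in
  fifth (E 5 K) · G ≈[ L ] E 1 K → G (suc (m ℕ.+ m) ℕ.+ suc (m ℕ.+ m)) ≡ (E 1 K · E 5 K) m
dissection m {G} G≈ = coeff odd-part (ℕₚ.n<1+n m)
  where
  open ≈-Reasoning
  open 𝔽₂-Solver
  L = suc (suc (m ℕ.+ m) ℕ.+ suc (m ℕ.+ m))
  K = L ℕ.+ L
  -- Precision halves twice: L = 4 m + 3 for G, H = 2 m + 2 for its even part, m + 1 for the odd
  -- part of that. The target 4 m + 2 = 2 (2 m + 1) is the last coefficient within reach.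
  H = suc (suc (m ℕ.+ m))
  E₁ = E 1 K
  E₂ = E 2 K
  E₅ = E 5 K
  E₁₀ = E 10 K
  E₂₀ = E 20 K

  H+H≤1+L : H ℕ.+ H ≤ suc L
  H+H≤1+L = ℕₚ.≤-reflexive (cong suc (ℕₚ.+-suc (suc (m ℕ.+ m)) (suc (m ℕ.+ m))))

  H≤L : H ≤ L
  H≤L = s≤s (ℕₚ.m≤m+n (suc (m ℕ.+ m)) (suc (m ℕ.+ m)))

  2+2m≤H : suc m ℕ.+ suc m ≤ H
  2+2m≤H = ℕₚ.≤-reflexive (cong suc (ℕₚ.+-suc m m))

  -- A further factor E₅ turns the denominator into E₅⁶ = E₁₀³, a series in q², and the numerator
  -- into E₁ E₅.
  whole : cube E₁₀ · G ≈[ L ] cube E₂ ⊕ cube E₁₀ · q^ 1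
  whole = begin
    cube E₁₀ · G               ≈⟨ ·-congʳ (cube-cong (≈-sym (frobenius 5 K))) ⟩
    cube (E₅ · E₅) · G         ≈⟨ solve 2 (λ x y → x :* x :* (x :* x) :* (x :* x) :* y := x :* (x :* (x :* (x :* (x :* x))) :* y)) ≈-refl E₅ G ⟩
    E₅ · (fifth E₅ · G)        ≈⟨ ·-congˡ G≈ ⟩
    E₅ · E₁                    ≈⟨ solve 2 (λ x y → x :* y := y :* x) ≈-refl E₅ E₁ ⟩
    E₁ · E₅                    ≈⟨ E₁E₅≈ L ⟩
    cube E₂ ⊕ cube E₁₀ · q^ 1  ∎

  even-part : cube E₅ · evens G ≈[ H ] cube E₁
  even-part = begin
    cube E₅ · evens G                                ≈⟨ evens-cube· 5 K G ⟨
    evens (cube E₁₀ · G)                             ≈⟨ evens-cong whole H+H≤1+L ⟩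
    evens (cube E₂ ⊕ cube E₁₀ · q^ 1)                ≈⟨ evens-⊕ (cube E₂) (cube E₁₀ · q^ 1) ⟩
    evens (cube E₂) ⊕ evens (cube E₁₀ · q^ 1)        ≈⟨ ⊕-cong (evens-cong {N = H ℕ.+ H} (≈-sym (cube E₂ ·𝟙)) (ℕₚ.n≤1+n _)) (evens-cube· 5 K (q^ 1)) ⟩
    evens (cube E₂ · 𝟙) ⊕ cube E₅ · evens (q^ 1)     ≈⟨ ⊕-cong (evens-cube· 1 K 𝟙) (·-congˡ evens-q) ⟩
    cube E₁ · evens 𝟙 ⊕ cube E₅ · 𝟘                  ≈⟨ ⊕-congʳ (·-congˡ evens-𝟙) ⟩
    cube E₁ · 𝟙 ⊕ cube E₅ · 𝟘                        ≈⟨ solve 2 (λ x y → x :* con true :+ y :* con false := x) ≈-refl (cube E₁) (cube E₅) ⟩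
    cube E₁                                          ∎

  -- Again a further E₅: the denominator becomes E₅⁴ = E₂₀, and E₁³ E₅ = E₂ · E₁ E₅ admits the
  -- congruence a second time.
  even-part-cleared : E₂₀ · evens G ≈[ H ] E₂ · (cube E₂ ⊕ cube E₁₀ · q^ 1)
  even-part-cleared = begin
    E₂₀ · evens G                       ≈⟨ ·-congʳ (≈-trans (≈-sym (frobenius 10 K)) (·-cong (≈-sym (frobenius 5 K)) (≈-sym (frobenius 5 K)))) ⟩
    E₅ · E₅ · (E₅ · E₅) · evens G       ≈⟨ solve 2 (λ x y → x :* x :* (x :* x) :* y := x :* (x :* x :* x :* y)) ≈-refl E₅ (evens G) ⟩
    E₅ · (cube E₅ · evens G)            ≈⟨ ·-congˡ even-part ⟩
    E₅ · cube E₁                        ≈⟨ solve 2 (λ x y → x :* (y :* y :* y) := y :* y :* (y :* x)) ≈-refl E₅ E₁ ⟩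
    E₁ · E₁ · (E₁ · E₅)                 ≈⟨ ·-cong (frobenius 1 K) (≈-weaken H≤L (E₁E₅≈ L)) ⟩
    E₂ · (cube E₂ ⊕ cube E₁₀ · q^ 1)    ∎

  odds-right : ∀ {N} → odds (E₂ · (cube E₂ ⊕ cube E₁₀ · q^ 1)) ≈[ N ] E₁ · cube E₅
  odds-right {N} = begin
    odds (E₂ · (cube E₂ ⊕ cube E₁₀ · q^ 1))               ≈⟨ odds-E· 1 K _ ⟩
    E₁ · odds (cube E₂ ⊕ cube E₁₀ · q^ 1)                 ≈⟨ ·-congˡ (odds-⊕ (cube E₂) (cube E₁₀ · q^ 1)) ⟩
    E₁ · (odds (cube E₂) ⊕ odds (cube E₁₀ · q^ 1))        ≈⟨ ·-congˡ (⊕-cong (odds-cong {N = N ℕ.+ N} (≈-sym (cube E₂ ·𝟙)) ℕₚ.≤-refl) (odds-cube· 5 K (q^ 1))) ⟩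
    E₁ · (odds (cube E₂ · 𝟙) ⊕ cube E₅ · odds (q^ 1))     ≈⟨ ·-congˡ (⊕-cong (≈-trans (odds-cube· 1 K 𝟙) (·-congˡ odds-𝟙)) (·-congˡ odds-q)) ⟩
    E₁ · (cube E₁ · 𝟘 ⊕ cube E₅ · 𝟙)                      ≈⟨ solve 3 (λ x y z → x :* (y :* con false :+ z :* con true) := x :* z) ≈-refl E₁ (cube E₁) (cube E₅) ⟩
    E₁ · cube E₅                                          ∎

  unit : (E₅ · E₅) 0 ≡ true
  unit = trans (·-coeff-zero E₅ E₅) (cong₂ _∧_ (poch-coeff₀ 5 K (s≤s z≤n)) (poch-coeff₀ 5 K (s≤s z≤n)))

  odd-part : odds (evens G) ≈[ suc m ] E₁ · E₅
  odd-part = unit-cancel (E₅ · E₅) unit (begin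
    E₅ · E₅ · odds (evens G)                       ≈⟨ ·-congʳ (frobenius 5 K) ⟩
    E₁₀ · odds (evens G)                           ≈⟨ odds-E· 10 K (evens G) ⟨
    odds (E₂₀ · evens G)                           ≈⟨ odds-cong even-part-cleared 2+2m≤H ⟩
    odds (E₂ · (cube E₂ ⊕ cube E₁₀ · q^ 1))        ≈⟨ odds-right ⟩
    E₁ · cube E₅                                   ≈⟨ solve 2 (λ x y → x :* (y :* y :* y) := y :* y :* (x :* y)) ≈-refl E₁ E₅ ⟩
    E₅ · E₅ · (E₁ · E₅)                            ∎)

-- The eta quotient modulo 2

bit : ℤ → Bool
bit z = odd ∣ z ∣

odd-+ : ∀ m n → odd (m ℕ.+ n) ≡ odd m xor odd n
odd-+ zero    n = refl
odd-+ (suc m) n = trans (cong not (odd-+ m n)) (not-distribˡ (odd m) (odd n))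
  where
  not-distribˡ : ∀ x y → not (x xor y) ≡ not x xor y
  not-distribˡ false y = refl
  not-distribˡ true  y = not-involutive y

bit-⊖ : ∀ m n → bit (m ⊖ n) ≡ odd m xor odd n
bit-⊖ zero    zero    = refl
bit-⊖ zero    (suc n) = refl
bit-⊖ (suc m) zero    = sym (xor-identityʳ _)
bit-⊖ (suc m) (suc n) = trans (cong bit (ℤₚ.[1+m]⊖[1+n]≡m⊖n m n)) (trans (bit-⊖ m n) (cancel (odd m) (odd n)))
  where
  cancel : ∀ x y → x xor y ≡ not x xor not y
  cancel false y = sym (not-involutive y)
  cancel true  y = refl

bit-+ : ∀ x y → bit (x + y) ≡ bit x xor bit y
bit-+ (+ m)    (+ n)    = odd-+ m n
bit-+ (+ m)    -[1+ n ] = bit-⊖ m (suc n)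
bit-+ -[1+ m ] (+ n)    = trans (bit-⊖ n (suc m)) (xor-comm (odd n) (odd (suc m)))
bit-+ -[1+ m ] -[1+ n ] = trans (cong (λ x → not (not x)) (odd-+ m n)) (cancel (odd m) (odd n))
  where
  cancel : ∀ x y → not (not (x xor y)) ≡ not x xor not y
  cancel false y = refl
  cancel true  y = not-involutive (not y)

bit-- : ∀ x y → bit (x - y) ≡ bit x xor bit y
bit-- x y = trans (bit-+ x (- y)) (cong (λ n → bit x xor odd n) (ℤₚ.∣-i∣≡∣i∣ y))

bit-mulFactor : ∀ a f {N} → bit ∘ mulFactor a f ≈[ N ] (𝟙 ⊕ q^ a) · (bit ∘ f)
bit-mulFactor a f = pointwise λ n → trans (go n) (sym (coeff-[1+q^]· a (bit ∘ f) n))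
  where
  go : ∀ n → bit (mulFactor a f n) ≡ bit (f n) xor (q^ a · (bit ∘ f)) n
  go n with a ≤? n
  ... | yes a≤n = trans (bit-- (f n) (f (n ∸ a))) (cong (bit (f n) xor_)
    (trans (sym (coeff-q^· a (bit ∘ f) (n ∸ a))) (cong (q^ a · (bit ∘ f)) (ℕₚ.m+[n∸m]≡n a≤n))))
  ... | no a≰n = trans (sym (xor-identityʳ _)) (cong (bit (f n) xor_) (sym (coeff-q^·-< (bit ∘ f) (ℕₚ.≰⇒> a≰n))))

-- The recursive call of `divFactor` at n carries fuel n, while the coefficient at n ∸ suc b is
-- defined with fuel suc (n ∸ suc b); both exceed the index.
divFuel-enough : ∀ {k l} b f n → n < k → n < l → divFuel k (suc b) f n ≡ divFuel l (suc b) f n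
divFuel-enough {suc k} {suc l} b f n (s≤s n≤k) (s≤s n≤l) with suc b ≤? n
... | yes b<n = cong (λ x → f n + x) (divFuel-enough b f (n ∸ suc b) (ℕₚ.<-≤-trans smaller n≤k) (ℕₚ.<-≤-trans smaller n≤l))
  where
  smaller : n ∸ suc b < n
  smaller = ℕₚ.∸-monoʳ-< (s≤s z≤n) b<n
... | no _ = refl

-- The geometric series telescopes: coefficient n is f n plus coefficient n - suc b, and adding the
-- shifted copy cancels the latter.
bit-divFactor : ∀ b f {N} → (𝟙 ⊕ q^ suc b) · (bit ∘ divFactor b f) ≈[ N ] bit ∘ f
bit-divFactor b f = pointwise λ n → trans (coeff-[1+q^]· (suc b) (bit ∘ divFactor b f) n) (go n)
  where
  go : ∀ n → bit (divFactor b f n) xor (q^ suc b · (bit ∘ divFactor b f)) n ≡ bit (f n)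
  go n with suc b ≤? n
  ... | no b≮n = trans (cong (bit (f n) xor_) (coeff-q^·-< (bit ∘ divFactor b f) (ℕₚ.≰⇒> b≮n))) (xor-identityʳ _)
  ... | yes b<n = begin
    bit (f n + rest) xor (q^ suc b · d) n      ≡⟨ cong₂ _xor_ (bit-+ (f n) rest) shifted ⟩
    (bit (f n) xor bit rest) xor bit rest        ≡⟨ xor-assoc (bit (f n)) (bit rest) (bit rest) ⟩
    bit (f n) xor (bit rest xor bit rest)        ≡⟨ cong (bit (f n) xor_) (xor-same (bit rest)) ⟩
    bit (f n) xor false                          ≡⟨ xor-identityʳ _ ⟩
    bit (f n)                                    ∎
    where
    open ≡-Reasoning
    d = bit ∘ divFactor b f
    rest = divFuel n (suc b) f (n ∸ suc b)
    shifted : (q^ suc b · d) n ≡ bit rest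
    shifted = begin
      (q^ suc b · d) n                        ≡⟨ cong (q^ suc b · d) (ℕₚ.m+[n∸m]≡n b<n) ⟨
      (q^ suc b · d) (suc b ℕ.+ (n ∸ suc b))  ≡⟨ coeff-q^· (suc b) d (n ∸ suc b) ⟩
      d (n ∸ suc b)                           ≡⟨ cong bit (divFuel-enough b f (n ∸ suc b) (ℕₚ.n<1+n _) (ℕₚ.∸-monoʳ-< (s≤s z≤n) b<n)) ⟩
      bit rest                                ∎

bit-mulFactor⁵ : ∀ a f {N} → bit ∘ iter 5 (mulFactor a) f ≈[ N ] fifth (𝟙 ⊕ q^ a) · (bit ∘ f)
bit-mulFactor⁵ a f = ≈-trans (step _ (step _ (step _ (step _ (bit-mulFactor a f)))))
  (solve 2 (λ x y → x :* (x :* (x :* (x :* (x :* y)))) := x :* (x :* (x :* (x :* x))) :* y) ≈-refl _ _)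
  where
  open 𝔽₂-Solver
  step : ∀ g {h N} → bit ∘ g ≈[ N ] h → bit ∘ mulFactor a g ≈[ N ] (𝟙 ⊕ q^ a) · h
  step g eq = ≈-trans (bit-mulFactor a g) (·-congˡ eq)

bit-divFactor⁵ : ∀ b f {N} → fifth (𝟙 ⊕ q^ suc b) · (bit ∘ iter 5 (divFactor b) f) ≈[ N ] bit ∘ f
bit-divFactor⁵ b f = begin
  fifth x · y 5                        ≈⟨ solve 2 (λ x y → x :* (x :* (x :* (x :* x))) :* y := x :* (x :* (x :* (x :* (x :* y))))) ≈-refl x (y 5) ⟩
  x · (x · (x · (x · (x · y 5))))      ≈⟨ ·-congˡ (·-congˡ (·-congˡ (·-congˡ (step 4)))) ⟩
  x · (x · (x · (x · y 4)))            ≈⟨ ·-congˡ (·-congˡ (·-congˡ (step 3))) ⟩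
  x · (x · (x · y 3))                  ≈⟨ ·-congˡ (·-congˡ (step 2)) ⟩
  x · (x · y 2)                        ≈⟨ ·-congˡ (step 1) ⟩
  x · y 1                              ≈⟨ step 0 ⟩
  y 0                                  ∎
  where
  open ≈-Reasoning
  open 𝔽₂-Solver
  x = 𝟙 ⊕ q^ suc b
  y : ℕ → 𝔽₂⟦q⟧
  y k = bit ∘ iter k (divFactor b) f
  step : ∀ k {N} → x · y (suc k) ≈[ N ] y k
  step k = bit-divFactor b (iter k (divFactor b) f)

frobenius-factor : ∀ a {N} → (𝟙 ⊕ q^ a) · (𝟙 ⊕ q^ a) ≈[ N ] 𝟙 ⊕ q^ (2 ℕ.* a)
frobenius-factor a = ≈-trans
  (solve 1 (λ x → (con true :+ x) :* (con true :+ x) := con true :+ x :* x) ≈-refl (q^ a))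
  (⊕-congˡ (≈-trans (q^-+ a a) (≈-reflexive (cong q^_ (double a)))))
  where
  open 𝔽₂-Solver
  double : ∀ a → a ℕ.+ a ≡ 2 ℕ.* a
  double = ℕ-Ring.solve-∀

coeff₀-factor : ∀ a → (𝟙 ⊕ q^ suc a) 0 ≡ true
coeff₀-factor a = trans (coeff-⊕ 𝟙 (q^ suc a) 0) (cong₂ _xor_ (coeff-q^ 0 0) (coeff-q^ (suc a) 0))

coeff₀-fifth : ∀ f → f 0 ≡ true → fifth f 0 ≡ true
coeff₀-fifth f f₀ = step (step (step (step f₀)))
  where
  step : ∀ {g} → g 0 ≡ true → (f · g) 0 ≡ true
  step {g} g₀ = trans (·-coeff-zero f g) (cong₂ _∧_ f₀ g₀)

-- With x = 1 - q^m and w = 1 - q^(5 m) for m = suc b, the factor is x² w⁵ / (x w¹⁰) = x / w⁵ modulo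
-- 2. Multiplying by x w⁵ first clears all denominators.
bit-etaFactor : ∀ b f {N} → fifth (𝟙 ⊕ q^ (5 ℕ.* suc b)) · (bit ∘ etaFactor b f) ≈[ N ] (𝟙 ⊕ q^ suc b) · (bit ∘ f)
bit-etaFactor b f = unit-cancel (x · fifth w) unit (begin
  x · fifth w · (fifth w · (bit ∘ etaFactor b f))
    ≈⟨ ·-congˡ (·-congˡ (≈-trans (bit-mulFactor (2 ℕ.* suc b) f₃) (·-cong (≈-sym (frobenius-factor (suc b))) (bit-mulFactor⁵ (5 ℕ.* suc b) f₂)))) ⟩
  x · fifth w · (fifth w · (x · x · (fifth w · g₂)))
    ≈⟨ solve 3 (λ x v g → x :* v :* (v :* (x :* x :* (v :* g))) := x :* x :* v :* (v :* v :* (x :* g))) ≈-refl x (fifth w) g₂ ⟩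
  x · x · fifth w · (fifth w · fifth w · (x · g₂))
    ≈⟨ ·-congˡ (·-cong square-fifth (bit-divFactor b f₁)) ⟩
  x · x · fifth w · (fifth (𝟙 ⊕ q^ (10 ℕ.* suc b)) · (bit ∘ f₁))
    ≈⟨ ·-congˡ (bit-divFactor⁵ (10 ℕ.* suc b ℕ.∸ 1) f) ⟩
  x · x · fifth w · (bit ∘ f)
    ≈⟨ solve 3 (λ x v g → x :* x :* v :* g := x :* v :* (x :* g)) ≈-refl x (fifth w) (bit ∘ f) ⟩
  x · fifth w · (x · (bit ∘ f)) ∎)
  where
  open ≈-Reasoning
  open 𝔽₂-Solver
  f₁ = iter 5 (divFactor (10 ℕ.* suc b ℕ.∸ 1)) f
  f₂ = divFactor b f₁
  f₃ = iter 5 (mulFactor (5 ℕ.* suc b)) f₂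
  g₂ = bit ∘ f₂
  x = 𝟙 ⊕ q^ suc b
  w = 𝟙 ⊕ q^ (5 ℕ.* suc b)
  unit : (x · fifth w) 0 ≡ true
  unit = trans (·-coeff-zero x (fifth w)) (cong₂ _∧_ (coeff₀-factor b) (coeff₀-fifth w (coeff₀-factor _)))
  ten : ∀ a → 2 ℕ.* (5 ℕ.* a) ≡ 10 ℕ.* a
  ten = ℕ-Ring.solve-∀
  square-w : ∀ {N} → w · w ≈[ N ] 𝟙 ⊕ q^ (10 ℕ.* suc b)
  square-w = ≈-trans (frobenius-factor (5 ℕ.* suc b)) (factor-cong (ten (suc b)))
  square-fifth : ∀ {N} → fifth w · fifth w ≈[ N ] fifth (𝟙 ⊕ q^ (10 ℕ.* suc b))
  square-fifth = ≈-trans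
    (solve 1 (λ w → w :* (w :* (w :* (w :* w))) :* (w :* (w :* (w :* (w :* w)))) :=
                    w :* w :* (w :* w :* (w :* w :* (w :* w :* (w :* w))))) ≈-refl w)
    (fifth-cong square-w)

bit-partialProd : ∀ M {N} → fifth (E 5 M) · (bit ∘ partialProd M) ≈[ N ] E 1 M
bit-partialProd zero    = ≈-trans
  (·-congˡ (pointwise λ { zero → sym (coeff-q^ 0 0) ; (suc n) → sym (coeff-q^ 0 (suc n)) }))
  (solve 0 (con true :* (con true :* (con true :* (con true :* con true))) :* con true := con true) ≈-refl)
  where open 𝔽₂-Solver
bit-partialProd (suc M) = begin
  fifth ((𝟙 ⊕ q^ (5 ℕ.+ 5 ℕ.* M)) · E 5 M) · g′
    ≈⟨ solve 3 (λ a b g → a :* b :* (a :* b :* (a :* b :* (a :* b :* (a :* b)))) :* g :=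
         b :* (b :* (b :* (b :* b))) :* (a :* (a :* (a :* (a :* a))) :* g)) ≈-refl (𝟙 ⊕ q^ (5 ℕ.+ 5 ℕ.* M)) (E 5 M) g′ ⟩
  fifth (E 5 M) · (fifth (𝟙 ⊕ q^ (5 ℕ.+ 5 ℕ.* M)) · g′)
    ≡⟨ cong (λ e → fifth (E 5 M) · (fifth (𝟙 ⊕ q^ e) · g′)) (ℕₚ.*-suc 5 M) ⟨
  fifth (E 5 M) · (fifth (𝟙 ⊕ q^ (5 ℕ.* suc M)) · g′)
    ≈⟨ ·-congˡ (bit-etaFactor M (partialProd M)) ⟩
  fifth (E 5 M) · ((𝟙 ⊕ q^ suc M) · (bit ∘ partialProd M))
    ≈⟨ solve 3 (λ x y z → x :* (y :* z) := y :* (x :* z)) ≈-refl (fifth (E 5 M)) (𝟙 ⊕ q^ suc M) (bit ∘ partialProd M) ⟩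
  (𝟙 ⊕ q^ suc M) · (fifth (E 5 M) · (bit ∘ partialProd M))
    ≈⟨ ·-cong (factor-cong (cong suc (sym (ℕₚ.*-identityˡ M)))) (bit-partialProd M) ⟩
  E 1 (suc M) ∎
  where
  open ≈-Reasoning
  open 𝔽₂-Solver
  g′ = bit ∘ partialProd (suc M)

-- `Fcoef I` stops after I factors, the theta identities after K = 2 (I + 1); modulo q^(I + 1) the
-- two truncations agree.
bit-Fcoef : ∀ m → let I = suc (m ℕ.+ m) ℕ.+ suc (m ℕ.+ m); K = suc I ℕ.+ suc I in
  bit (Fcoef I) ≡ (E 1 K · E 5 K) m
bit-Fcoef m = dissection m (begin
  fifth (E 5 K) · (bit ∘ partialProd I)  ≈⟨ ·-congʳ (fifth-cong (E≈ 5 (s≤s z≤n))) ⟩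
  fifth (E 5 I) · (bit ∘ partialProd I)  ≈⟨ bit-partialProd I ⟩
  E 1 I                                  ≈⟨ E≈ 1 (s≤s z≤n) ⟨
  E 1 K                                  ∎)
  where
  open ≈-Reasoning
  I = suc (m ℕ.+ m) ℕ.+ suc (m ℕ.+ m)
  K = suc I ℕ.+ suc I
  E≈ : ∀ t → 1 ≤ t → E t K ≈[ suc I ] E t I
  E≈ t 1≤t = poch-truncate (ℕₚ.+-mono-≤ 1≤t (ℕₚ.m≤n*m I t {{ℕ.>-nonZero 1≤t}})) (ℕₚ.≤-trans (ℕₚ.n≤1+n I) (ℕₚ.m≤m+n (suc I) (suc I)))

parity-witness : {A : Set} {P : Pred A 0ℓ} (P? : Decidable P) → ∀ xs → parity P? xs ≡ true → ∃ P
parity-witness P? (x ∷ xs) eq with P? x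
... | yes p = x , p
... | no _  = parity-witness P? xs eq

-- An odd count has a solution, and completing the square in its exponent equation yields x. The
-- factor 1 is written out so that both cases have the shape c x² treated by `≢c·square`.
square-or-5·square : ∀ m → bit (Fcoef (suc (m ℕ.+ m) ℕ.+ suc (m ℕ.+ m))) ≡ true →
  (∃ λ x → + 4 * + m + + 1 ≡ + 1 * (x * x)) ⊎ (∃ λ x → + 4 * + m + + 1 ≡ + 5 * (x * x))
square-or-5·square m is-odd = conclude _ _ refl refl (trans (sym (coeff-E₁E₅ L m<L)) (trans (sym (bit-Fcoef m)) is-odd))
  where
  L = suc (suc (m ℕ.+ m) ℕ.+ suc (m ℕ.+ m))
  m<L : m < L
  m<L = s≤s (ℕₚ.≤-trans (ℕₚ.m≤m+n m m) (ℕₚ.≤-trans (ℕₚ.n≤1+n _) (ℕₚ.m≤m+n _ _)))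
  J = interval (L ℕ.+ L)
  Ψ₁? : Decidable (λ j → Theta.exponent 8 2 6 refl j ≡ m)
  Ψ₁? j = Theta.exponent 8 2 6 refl j ℕ.≟ m
  Ψ₅? : Decidable (λ j → 1 ℕ.+ Theta.exponent 40 10 30 refl j ≡ m)
  Ψ₅? j = 1 ℕ.+ Theta.exponent 40 10 30 refl j ℕ.≟ m
  conclude : ∀ a b → parity Ψ₁? J ≡ a → parity Ψ₅? J ≡ b → a xor b ≡ true →
    (∃ λ x → + 4 * + m + + 1 ≡ + 1 * (x * x)) ⊎ (∃ λ x → + 4 * + m + + 1 ≡ + 5 * (x * x))
  conclude true  _    eq _  _ with j , refl ← parity-witness Ψ₁? J eq =
    inj₁ (+ 1 - + 4 * j , trans (Lattice.Ψ₁-norm m j) (sym (ℤₚ.*-identityˡ _)))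
  conclude false true _  eq _ with j , refl ← parity-witness Ψ₅? J eq =
    inj₂ (+ 1 - + 4 * j , Lattice.Ψ₅-norm m j)

-- Arithmetic of the argument of 𝒥₁₀

-- Up to 5 the only number that is 3 modulo 4 is 3 itself.
3mod4-∤ : ∀ {p} c → p % 4 ≡ 3 → ¬ (3 ℕ∣.∣ suc c) → suc c ≤ 5 → ¬ (p ℕ∣.∣ suc c)
3mod4-∤ {p} c p%4≡3 3∤c c≤5 p∣c = go p p%4≡3 (ℕₚ.≤-trans (ℕ∣.∣⇒≤ p∣c) c≤5) p∣c
  where
  go : ∀ p → p % 4 ≡ 3 → p ≤ 5 → ¬ (p ℕ∣.∣ suc c)
  go 3 _ _ = 3∤c
  go (suc (suc (suc (suc (suc (suc _)))))) _ (s≤s (s≤s (s≤s (s≤s (s≤s ())))))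

prime-∣-square : ∀ {p} c x → Prime p → ¬ (p ℕ∣.∣ c) → p ℕ∣.∣ c ℕ.* (x ℕ.* x) → p ℕ∣.∣ x
prime-∣-square c x pr p∤c p∣ with euclidsLemma c (x ℕ.* x) pr p∣
... | inj₁ p∣c  = contradiction p∣c p∤c
... | inj₂ p∣xx with euclidsLemma x x pr p∣xx
...   | inj₁ p∣x = p∣x
...   | inj₂ p∣x = p∣x

-- Each prime divides c x² but not c, hence x, and its square cancels. One square is removed at a
-- time, so repeated primes are covered.
cancel-prime-squares : {A : Set} (π : A → ℕ) (c : ℕ) → (∀ i → Prime (π i)) → (∀ i → ¬ (π i ℕ∣.∣ c)) →
  ∀ is Y x → product (map (λ i → π i ℕ.^ 2) is) ℕ.* Y ≡ c ℕ.* (x ℕ.* x) → ∃ λ x′ → Y ≡ c ℕ.* (x′ ℕ.* x′)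
cancel-prime-squares π c π-prime ∤c []       Y x eq = x , trans (sym (ℕₚ.*-identityˡ Y)) eq
cancel-prime-squares π c π-prime ∤c (i ∷ is) Y x eq
  with prime-∣-square c x (π-prime i) (∤c i) (ℕ∣.divides (p ℕ.* P ℕ.* Y) (trans (sym eq) (pull p P Y)))
  where
  p = π i
  P = product (map (λ i → π i ℕ.^ 2) is)
  pull : ∀ p P Y → p ℕ.* (p ℕ.* 1) ℕ.* P ℕ.* Y ≡ p ℕ.* P ℕ.* Y ℕ.* p
  pull = ℕ-Ring.solve-∀
... | ℕ∣.divides y refl = cancel-prime-squares π c π-prime ∤c is Y y
  (ℕₚ.*-cancelˡ-≡ _ _ p (ℕₚ.*-cancelˡ-≡ _ _ p (trans (left p P Y) (trans eq (right p c y)))))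
  where
  p = π i
  instance _ = prime⇒nonZero (π-prime i)
  P = product (map (λ i → π i ℕ.^ 2) is)
  left : ∀ p P Y → p ℕ.* (p ℕ.* (P ℕ.* Y)) ≡ p ℕ.* (p ℕ.* 1) ℕ.* P ℕ.* Y
  left = ℕ-Ring.solve-∀
  right : ∀ p c y → c ℕ.* (y ℕ.* p ℕ.* (y ℕ.* p)) ≡ p ℕ.* (p ℕ.* (c ℕ.* (y ℕ.* y)))
  right = ℕ-Ring.solve-∀

3mod4 : ∀ p → p % 4 ≡ 3 → ∃ λ r → p ≡ 3 ℕ.+ 4 ℕ.* r
3mod4 p p%4≡3 = p ℕ./ 4 , trans (m≡m%n+[m/n]*n p 4) (cong₂ ℕ._+_ p%4≡3 (ℕₚ.*-comm (p ℕ./ 4) 4))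

product-squares-1mod4 : {A : Set} (π : A → ℕ) → (∀ i → π i % 4 ≡ 3) →
  ∀ is → ∃ λ z → product (map (λ i → π i ℕ.^ 2) is) ≡ 1 ℕ.+ 4 ℕ.* z
product-squares-1mod4 π π≡3 []       = 0 , refl
product-squares-1mod4 π π≡3 (i ∷ is)
  with r , p≡ ← 3mod4 (π i) (π≡3 i) | z , P≡ ← product-squares-1mod4 π π≡3 is =
  -- From (3 + 4 r)² = 1 + 4 (2 + 6 r + 4 r²).
  z ℕ.+ (2 ℕ.+ 6 ℕ.* r ℕ.+ 4 ℕ.* r ℕ.* r) ℕ.* (1 ℕ.+ 4 ℕ.* z) , trans (cong₂ (λ p P → p ℕ.^ 2 ℕ.* P) p≡ P≡) (expand r z)
  where
  expand : ∀ r z → (3 ℕ.+ 4 ℕ.* r) ℕ.* ((3 ℕ.+ 4 ℕ.* r) ℕ.* 1) ℕ.* (1 ℕ.+ 4 ℕ.* z) ≡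
    1 ℕ.+ 4 ℕ.* (z ℕ.+ (2 ℕ.+ 6 ℕ.* r ℕ.+ 4 ℕ.* r ℕ.* r) ℕ.* (1 ℕ.+ 4 ℕ.* z))
  expand = ℕ-Ring.solve-∀

even⇒2∣ : ∀ n → odd n ≡ false → 2 ℕ∣.∣ n
even⇒2∣ zero          _  = 2 ℕ∣.∣0
even⇒2∣ (suc (suc n)) eq = ℕ∣.∣m∣n⇒∣m+n ℕ∣.∣-refl (even⇒2∣ n (trans (sym (not-involutive (odd n))) eq))

-- A negative j can make the argument nonpositive. At 0 and below -1 the coefficient is 0; at -1 it
-- is 1, but -1 is not 1 modulo 4. The dissection handles the positive arguments.
J10-even : ∀ Z z → Z ≡ + 4 * z + + 1 →
  (∀ x → Z ≢ + 1 * (x * x)) → (∀ x → Z ≢ + 5 * (x * x)) → + 2 ∣ J10 Z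
J10-even (+ zero)        z _  _  _  = ℕ∣.divides 0 refl
J10-even +[1+ k ]        z Z≡ ≢□ ≢5□ = even⇒2∣ ∣ Fcoef (suc (suc k)) ∣ (¬-not not-odd)
  where
  1+k≡ : + k ≡ + 4 * z
  1+k≡ = trans (strip (+ k)) (trans (cong (λ x → x - + 1) Z≡) (sym (strip′ z)))
    where
    strip : ∀ k → k ≡ + 1 + k - + 1
    strip = ℤ-Ring.solve-∀
    strip′ : ∀ z → + 4 * z ≡ + 4 * z + + 1 - + 1
    strip′ = ℤ-Ring.solve-∀
  quarter : ∀ z → + k ≡ + 4 * z → ∃ λ m → k ≡ 4 ℕ.* m
  quarter (+ m) eq = m , ℤₚ.+-injective (trans eq (sym (ℤₚ.pos-* 4 m)))
  m = proj₁ (quarter z 1+k≡)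
  k≡ = proj₂ (quarter z 1+k≡)
  Z≡4m+1 : + suc k ≡ + 4 * + m + + 1
  Z≡4m+1 = trans (cong (λ x → + suc x) k≡) (trans (cong +_ (ℕₚ.+-comm 1 (4 ℕ.* m))) (cong (_+ + 1) (ℤₚ.pos-* 4 m)))
  -- The coefficient of q^(4 m + 1) in j₁₀ sits at 4 m + 2 in F = q (j₁₀ + 1).
  index : ∀ m → suc (suc (4 ℕ.* m)) ≡ suc (m ℕ.+ m) ℕ.+ suc (m ℕ.+ m)
  index = ℕ-Ring.solve-∀
  not-odd : bit (Fcoef (suc (suc k))) ≢ true
  not-odd is-odd = [ (λ (x , eq) → ≢□ x (trans Z≡4m+1 eq)) , (λ (x , eq) → ≢5□ x (trans Z≡4m+1 eq)) ]′
    (square-or-5·square m (trans (cong (bit ∘ Fcoef) (sym (trans (cong (suc ∘ suc) k≡) (index m)))) is-odd))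
J10-even -[1+ zero ]     z Z≡ _ _  = contradiction
  (ℤ∣.divides z (trans (cong (λ x → x - + 1) Z≡) (strip z))) (from-no (+ 4 ∣? -[1+ 1 ]))
  where
  strip : ∀ z → + 4 * z + + 1 - + 1 ≡ z * + 4
  strip = ℤ-Ring.solve-∀
J10-even -[1+ suc _ ]    z _  _  _  = ℕ∣.divides 0 refl

4·[πn+j]+π : ∀ π n j → + (4 ℕ.* π ℕ.* n) + + 4 * j + + π ≡ + 4 * (+ π * + n + j) + + π
4·[πn+j]+π π n j = trans
  (cong (λ x → x + + 4 * j + + π) (trans (ℤₚ.pos-* (4 ℕ.* π) n) (cong (_* + n) (ℤₚ.pos-* 4 π))))
  (collect (+ π) (+ n) j)
  where
  collect : ∀ π n j → + 4 * π * n + + 4 * j + π ≡ + 4 * (π * n + j) + π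
  collect = ℤ-Ring.solve-∀

-- Modulo π the number is 4 j, and a prime that is 3 modulo 4 does not divide 4.
∤-4·[πn+j]+π : ∀ π n j → Prime π → π % 4 ≡ 3 → ¬ (+ π ∣ j) → ¬ (+ π ∣ + (4 ℕ.* π ℕ.* n) + + 4 * j + + π)
∤-4·[πn+j]+π π n j π-prime π≡3 π∤j π∣M =
  [ 3mod4-∤ 3 π≡3 (from-no (3 ℕ∣.∣? 4)) (ℕₚ.n≤1+n 4) , π∤j ]′
    (euclidsLemma 4 ∣ j ∣ π-prime (subst (π ℕ∣.∣_) (ℤₚ.abs-* (+ 4) j) (ℤ∣.∣⇒∣ᵤ 4j)))
  where
  isolate : ∀ π n j → + 4 * j ≡ + 1 * (+ 4 * (π * n + j) + π) + (- (+ 4 * n) - + 1) * π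
  isolate = ℤ-Ring.solve-∀
  4j : + π ℤ∣.∣ + 4 * j
  4j = ∣-linear (+ 1) (- (+ 4 * + n) - + 1) (subst (+ π ℤ∣.∣_) (4·[πn+j]+π π n j) (ℤ∣.∣ᵤ⇒∣ π∣M))
    (isolate (+ π) (+ n) j)

-- Modulo 4 the product is P π², with P ≡ 1 and π² ≡ 9 ≡ 1.
1mod4-product : ∀ {P} π w → (∃ λ u → P ≡ 1 ℕ.+ 4 ℕ.* u) → π % 4 ≡ 3 →
  ∃ λ z → + (P ℕ.* π) * (+ 4 * w + + π) ≡ + 4 * z + + 1
1mod4-product {P} π w (u , P≡) π≡3 with r , π≡ ← 3mod4 π π≡3 = x + (+ 2 + + 6 * + r + + 4 * + r * + r) , (begin
  + (P ℕ.* π) * (+ 4 * w + + π)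
    ≡⟨ cong (λ y → y * (+ 4 * w + + π)) (ℤₚ.pos-* P π) ⟩
  + P * + π * (+ 4 * w + + π)
    ≡⟨ cong (λ y → y * + π * (+ 4 * w + + π)) (trans (cong +_ P≡) (cong (λ y → + 1 + y) (ℤₚ.pos-* 4 u))) ⟩
  (+ 1 + + 4 * + u) * + π * (+ 4 * w + + π)
    ≡⟨ expand (+ u) (+ π) w ⟩
  + 4 * x + + π * + π
    ≡⟨ cong (λ y → + 4 * x + y * y) (trans (cong +_ π≡) (cong (λ y → + 3 + y) (ℤₚ.pos-* 4 r))) ⟩
  + 4 * x + (+ 3 + + 4 * + r) * (+ 3 + + 4 * + r)
    ≡⟨ complete x (+ r) ⟩
  + 4 * (x + (+ 2 + + 6 * + r + + 4 * + r * + r)) + + 1 ∎)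
  where
  open ≡-Reasoning
  x = + u * + π * (+ 4 * w + + π) + + π * w
  expand : ∀ u a w → (+ 1 + + 4 * u) * a * (+ 4 * w + a) ≡ + 4 * (u * a * (+ 4 * w + a) + a * w) + a * a
  expand = ℤ-Ring.solve-∀
  complete : ∀ x r → + 4 * x + (+ 3 + + 4 * r) * (+ 3 + + 4 * r) ≡ + 4 * (x + (+ 2 + + 6 * r + + 4 * r * r)) + + 1
  complete = ℤ-Ring.solve-∀

-- Once the prime squares are cancelled, π |M| = c y² would contain π exactly once on the left and
-- to an even power on the right.
≢c·square : {A : Set} (ϖ : A → ℕ) (is : List A) (π : ℕ) (M : ℤ) (c : ℕ) →
  (∀ i → Prime (ϖ i)) → (∀ i → ¬ (ϖ i ℕ∣.∣ c)) → Prime π → ¬ (π ℕ∣.∣ c) → ¬ (+ π ∣ M) →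
  ∀ x → + (product (map (λ i → ϖ i ℕ.^ 2) is) ℕ.* π) * M ≢ + c * (x * x)
≢c·square ϖ is π M c ϖ-prime ϖ∤c π-prime π∤c π∤M x Z≡ =
  remaining-square (cancel-prime-squares ϖ c ϖ-prime ϖ∤c is (π ℕ.* ∣ M ∣) ∣ x ∣ absolute-values)
  where
  P = product (map (λ i → ϖ i ℕ.^ 2) is)
  absolute-values : P ℕ.* (π ℕ.* ∣ M ∣) ≡ c ℕ.* (∣ x ∣ ℕ.* ∣ x ∣)
  absolute-values = begin
    P ℕ.* (π ℕ.* ∣ M ∣)     ≡⟨ ℕₚ.*-assoc P π ∣ M ∣ ⟨
    P ℕ.* π ℕ.* ∣ M ∣       ≡⟨ ℤₚ.abs-* (+ (P ℕ.* π)) M ⟨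
    ∣ + (P ℕ.* π) * M ∣     ≡⟨ cong ∣_∣ Z≡ ⟩
    ∣ + c * (x * x) ∣       ≡⟨ ℤₚ.abs-* (+ c) (x * x) ⟩
    c ℕ.* ∣ x * x ∣         ≡⟨ cong (c ℕ.*_) (ℤₚ.abs-* x x) ⟩
    c ℕ.* (∣ x ∣ ℕ.* ∣ x ∣) ∎
    where open ≡-Reasoning
  remaining-square : ¬ ∃ λ y → π ℕ.* ∣ M ∣ ≡ c ℕ.* (y ℕ.* y)
  remaining-square (y , eq)
    with prime-∣-square c y π-prime π∤c (ℕ∣.divides ∣ M ∣ (trans (sym eq) (ℕₚ.*-comm π ∣ M ∣)))
  ... | ℕ∣.divides w refl = π∤M (ℕ∣.divides (c ℕ.* (w ℕ.* w))
          (ℕₚ.*-cancelˡ-≡ _ _ π {{prime⇒nonZero π-prime}} (trans eq (regroup c w π))))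
    where
    regroup : ∀ c w π → c ℕ.* (w ℕ.* π ℕ.* (w ℕ.* π)) ≡ π ℕ.* (c ℕ.* (w ℕ.* w) ℕ.* π)
    regroup = ℕ-Ring.solve-∀

theorem4p2 : (k n : ℕ) (p : Fin (suc k) → ℕ) →
    ((i : Fin (suc k)) → Prime (p i)) →
    ((i : Fin (suc k)) → p i % 4 ≡ 3) →
    (j : ℤ) → ¬ (+ p (fromℕ k) ∣ j) →
    + 2 ∣ J10 (+ (product (map (λ i → p (inject₁ i) ℕ.^ 2) (allFin k)) ℕ.* p (fromℕ k))
    ℤ.* (+ (4 ℕ.* p (fromℕ k) ℕ.* n) ℤ.+ + 4 ℤ.* j ℤ.+ + p (fromℕ k)))
theorem4p2 k n p p-prime p≡3 j p∤j = J10-even Z (proj₁ Z≡1) (proj₂ Z≡1)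
  -- `not-square` takes the predecessor of the coefficient: 0 and 4 stand for the forms x² and 5 x².
  (not-square 0 (from-no (3 ℕ∣.∣? 1)) (s≤s z≤n))
  (not-square 4 (from-no (3 ℕ∣.∣? 5)) ℕₚ.≤-refl)
  where
  π = p (fromℕ k)
  P = product (map (λ i → p (inject₁ i) ℕ.^ 2) (allFin k))
  M = + (4 ℕ.* π ℕ.* n) + + 4 * j + + π
  Z = + (P ℕ.* π) * M
  P≡1 : ∃ λ u → P ≡ 1 ℕ.+ 4 ℕ.* u
  P≡1 = product-squares-1mod4 (p ∘ inject₁) (p≡3 ∘ inject₁) (allFin k)

  Z≡1 : ∃ λ z → Z ≡ + 4 * z + + 1
  Z≡1 = subst (λ x → ∃ λ z → + (P ℕ.* π) * x ≡ + 4 * z + + 1) (sym (4·[πn+j]+π π n j))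
    (1mod4-product π (+ π * + n + j) P≡1 (p≡3 (fromℕ k)))

  not-square : ∀ c → ¬ (3 ℕ∣.∣ suc c) → suc c ≤ 5 → ∀ x → Z ≢ + suc c * (x * x)
  not-square c 3∤c c≤5 = ≢c·square (p ∘ inject₁) (allFin k) π M (suc c)
    (p-prime ∘ inject₁) (λ i → 3mod4-∤ c (p≡3 (inject₁ i)) 3∤c c≤5)
    (p-prime (fromℕ k)) (3mod4-∤ c (p≡3 (fromℕ k)) 3∤c c≤5)
    (∤-4·[πn+j]+π π n j (p-prime (fromℕ k)) (p≡3 (fromℕ k)) p∤j)
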